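{- For $u,v,n\in\mathbb{N}$, let $C_4(u,v,n)$ be the number of partitions of $n$ into $u$ distinct parts congruent to $1$ modulo $4$ and $v$ distinct parts congruent to $3$ modulo $4$. Let $D_4(u,v,n)$ be the number of partitions $\lambda_1+\cdots+\lambda_s$ of $n$ (positive integer parts, $\lambda_1\ge\dots\ge\lambda_s$) satisfying: (1) $\lambda_i\neq 2$ for all $i$; (2) $\lambda_i-\lambda_{i+1}\ge5$ for all $1\le i<s$; (3) for all $1\le i<s$: if $\lambda_i-\lambda_{i+1}=5$ then $\lambda_i\equiv1,4\pmod 8$; if $\lambda_i-\lambda_{i+1}=6$ then $\lambda_i\equiv1,3,5,7\pmod 8$; if $\lambda_i-\lambda_{i+1}=7$ then $\lambda_i\equiv0,1,3,4,6,7\pmod 8$; if $\lambda_i-\lambda_{i+1}=8$ then $\lambda_i\equiv0,1,3,4,5,7\pmod 8$; and such that $u$ equals the number of parts congruent to $0$ or $1$ modulo $4$ plus twice the number of parts congruent to $6$ modulo $8$, and $v$ equals the number of parts congruent to $0$ or $3$ modulo $4$ plus twice the number of parts congruent to $2$ modulo $8$. Then $C_4(u,v,n)=D_4(u,v,n)$ for all $u,v,n$. -}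

module Defs where

open import Data.Empty using (⊥; ⊥-elim)
open import Data.List using (List; []; _∷_; _++_; map; filter; length)
open import Data.List.Membership.DecPropositional using (_∈?_)
open import Data.List.Membership.Propositional using (_∈_)
open import Data.List.Membership.Propositional.Properties using (∈-map⁺; ∈-map⁻; ∈-++⁺ˡ; ∈-++⁺ʳ; ∈-++⁻)
open import Data.List.Properties using (∷-injectiveʳ)
open import Data.List.Relation.Unary.All using (All; []; _∷_; all?)
open import Data.List.Relation.Unary.AllPairs using ([]; _∷_)
open import Data.List.Relation.Unary.Any using (here)
open import Data.List.Relation.Unary.Linked using (Linked; []; [-]; _∷_; linked?)
open import Data.List.Relation.Unary.Unique.DecPropositional using (unique?)
open import Data.List.Relation.Unary.Unique.Propositional using (Unique)
open import Data.List.Relation.Unary.Unique.Propositional.Properties using (map⁺; ++⁺)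
open import Data.Nat using (ℕ; zero; suc; _+_; _*_; _∸_; _%_; _≤_; _≥_; z≤n; s≤s; NonZero; _≟_; _≤?_; _≥?_)
open import Data.Nat.Properties using (≤-refl; ≤-trans; ≤-pred; m≤n⇒m≤1+n; m+[n∸m]≡n; m+n∸m≡n; m≤m+n; m≤n+m; 1+n≰n; m≤n⇒m<n∨m≡n)
open import Data.Nat.ListAction using (sum)
open import Data.Product using (_×_; _,_; proj₁)
open import Data.Sum using (inj₁; inj₂)
open import Function using (_⇔_; mk⇔)
open import Relation.Binary.Definitions as Binary using ()
open import Relation.Binary.PropositionalEquality using (_≡_; _≢_; refl; sym; trans; cong; subst)
open import Relation.Nullary using (yes; no)
open import Relation.Nullary.Decidable using (_×-dec_; _→-dec_; ¬?)
open import Relation.Unary using (Pred; Decidable)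
open import Level using (0ℓ)

IsPartition : ℕ → List ℕ → Set
IsPartition n λs = Linked _≥_ λs × All (_≥ 1) λs × sum λs ≡ n

-- partitionsBelow f m n lists the partitions of n with at most f parts, all
-- of them at most m.
partitionsBelow : ℕ → ℕ → ℕ → List (List ℕ)
partitionsBelow f       zero    zero    = [] ∷ []
partitionsBelow f       zero    (suc n) = []
partitionsBelow zero    (suc m) n       = partitionsBelow zero m n
partitionsBelow (suc f) (suc m) n with suc m ≤? n
... | yes _ = map (suc m ∷_) (partitionsBelow f (suc m) (n ∸ suc m)) ++ partitionsBelow (suc f) m n
... | no  _ = partitionsBelow (suc f) m n

-- See ∈-partitions and partitions-unique below: every partition of n occurs
-- in this list exactly once, and nothing else does.
partitions : ℕ → List (List ℕ)
partitions n = partitionsBelow n n n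

#partitions : {P : Pred (List ℕ) 0ℓ} → Decidable P → ℕ → ℕ
#partitions P? n = length (filter P? (partitions n))

-- x ≅ r₁ ∷ … ∷ rₖ ∷ [] [mod m]  means  x ≡ r₁, …, or rₖ (mod m); the
-- residues are always given reduced.
infix 4 _≅_[mod_]

_≅_[mod_] : ℕ → List ℕ → (m : ℕ) → .{{NonZero m}} → Set
x ≅ rs [mod m ] = x % m ∈ rs

≅? : (rs : List ℕ) (m : ℕ) .{{_ : NonZero m}} → Decidable (_≅ rs [mod m ])
≅? rs m x = _∈?_ _≟_ (x % m) rs

#parts : List ℕ → (m : ℕ) → .{{NonZero m}} → List ℕ → ℕ
#parts rs m λs = length (filter (≅? rs m) λs)

C₄-Condition : ℕ → ℕ → List ℕ → Set
C₄-Condition u v λs =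
    Unique λs
  × All (_≅ 1 ∷ 3 ∷ [] [mod 4 ]) λs
  × #parts (1 ∷ []) 4 λs ≡ u
  × #parts (3 ∷ []) 4 λs ≡ v

C₄-condition? : ∀ u v → Decidable (C₄-Condition u v)
C₄-condition? u v λs =
    unique? _≟_ λs
  ×-dec all? (≅? (1 ∷ 3 ∷ []) 4) λs
  ×-dec (#parts (1 ∷ []) 4 λs ≟ u)
  ×-dec (#parts (3 ∷ []) 4 λs ≟ v)

C₄ : ℕ → ℕ → ℕ → ℕ
C₄ u v n = #partitions (C₄-condition? u v) n

-- The condition on consecutive parts a = λᵢ, b = λᵢ₊₁.  Truncated subtraction
-- is harmless: the first conjunct forces a > b.
Gap : ℕ → ℕ → Set
Gap a b =
    a ∸ b ≥ 5
  × (a ∸ b ≡ 5 → a ≅ 1 ∷ 4 ∷ [] [mod 8 ])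
  × (a ∸ b ≡ 6 → a ≅ 1 ∷ 3 ∷ 5 ∷ 7 ∷ [] [mod 8 ])
  × (a ∸ b ≡ 7 → a ≅ 0 ∷ 1 ∷ 3 ∷ 4 ∷ 6 ∷ 7 ∷ [] [mod 8 ])
  × (a ∸ b ≡ 8 → a ≅ 0 ∷ 1 ∷ 3 ∷ 4 ∷ 5 ∷ 7 ∷ [] [mod 8 ])

gap? : Binary.Decidable Gap
gap? a b =
    (a ∸ b ≥? 5)
  ×-dec ((a ∸ b ≟ 5) →-dec ≅? _ 8 a)
  ×-dec ((a ∸ b ≟ 6) →-dec ≅? _ 8 a)
  ×-dec ((a ∸ b ≟ 7) →-dec ≅? _ 8 a)
  ×-dec ((a ∸ b ≟ 8) →-dec ≅? _ 8 a)

D₄-Condition : ℕ → ℕ → List ℕ → Set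
D₄-Condition u v λs =
    All (_≢ 2) λs
  × Linked Gap λs
  × u ≡ #parts (0 ∷ 1 ∷ []) 4 λs + 2 * #parts (6 ∷ []) 8 λs
  × v ≡ #parts (0 ∷ 3 ∷ []) 4 λs + 2 * #parts (2 ∷ []) 8 λs

D₄-condition? : ∀ u v → Decidable (D₄-Condition u v)
D₄-condition? u v λs =
    all? (λ x → ¬? (x ≟ 2)) λs
  ×-dec linked? gap? λs
  ×-dec (u ≟ _)
  ×-dec (v ≟ _)

D₄ : ℕ → ℕ → ℕ → ℕ
D₄ u v n = #partitions (D₄-condition? u v) n

private
  HeadBound : ℕ → List ℕ → Set
  HeadBound m λs = Linked _≥_ (m ∷ λs)

  weaken : ∀ {m λs} → HeadBound m λs → HeadBound (suc m) λs
  weaken [-]       = [-]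
  weaken (p ∷ ps)  = m≤n⇒m≤1+n p ∷ ps

  tail′ : ∀ {m λs} → HeadBound m λs → Linked _≥_ λs
  tail′ [-]      = []
  tail′ (_ ∷ ps) = ps

  sound : ∀ f m n {λs} → λs ∈ partitionsBelow f m n →
          HeadBound m λs × All (_≥ 1) λs × sum λs ≡ n
  sound f zero zero (here refl) = [-] , [] , refl
  sound zero (suc m) n p with sound zero m n p
  ... | h , q = weaken h , q
  sound (suc f) (suc m) n p with suc m ≤? n
  sound (suc f) (suc m) n p | no _ with sound (suc f) m n p
  ... | h , q = weaken h , q
  sound (suc f) (suc m) n p | yes m<n
    with ∈-++⁻ (map (suc m ∷_) (partitionsBelow f (suc m) (n ∸ suc m))) p
  ... | inj₂ p₂ with sound (suc f) m n p₂
  ...   | h , q = weaken h , q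
  sound (suc f) (suc m) n p | yes m<n | inj₁ p₁ with ∈-map⁻ (suc m ∷_) p₁
  ... | μs , μs∈ , refl with sound f (suc m) (n ∸ suc m) μs∈
  ...   | h , pos , s =
    (≤-refl ∷ h) , (s≤s z≤n ∷ pos) , trans (cong (suc m +_) s) (m+[n∸m]≡n m<n)

  complete : ∀ f m n {λs} → length λs ≤ f → HeadBound m λs → All (_≥ 1) λs →
             sum λs ≡ n → λs ∈ partitionsBelow f m n
  complete f zero zero {[]} _ _ _ _ = here refl
  complete f zero n {zero ∷ _} _ _ (() ∷ _) _
  complete f zero n {suc x ∷ _} _ (() ∷ _) _ _
  complete zero (suc m) n {[]} l h pos s = complete zero m n l [-] [] s
  complete (suc f) (suc m) n {[]} l h pos refl = complete (suc f) m n l [-] [] refl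
  complete (suc f) (suc m) n {x ∷ λs} (s≤s l) (x≤ ∷ h) (x≥1 ∷ pos) s
    with suc m ≤? n | m≤n⇒m<n∨m≡n x≤
  ... | yes _ | inj₁ x< = ∈-++⁺ʳ _ (complete (suc f) m n (s≤s l) (≤-pred x< ∷ h) (x≥1 ∷ pos) s)
  ... | yes _ | inj₂ refl = ∈-++⁺ˡ (∈-map⁺ (suc m ∷_)
          (complete f (suc m) (n ∸ suc m) l h pos
            (trans (sym (m+n∸m≡n (suc m) (sum λs))) (cong (_∸ suc m) s))))
  ... | no _ | inj₁ x< = complete (suc f) m n (s≤s l) (≤-pred x< ∷ h) (x≥1 ∷ pos) s
  ... | no m≮n | inj₂ refl = ⊥-elim (m≮n (subst (suc m ≤_) s (m≤m+n (suc m) (sum λs))))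

  below-unique : ∀ f m n → Unique (partitionsBelow f m n)
  below-unique f zero zero = [] ∷ []
  below-unique f zero (suc n) = []
  below-unique zero (suc m) n = below-unique zero m n
  below-unique (suc f) (suc m) n with suc m ≤? n
  ... | no _ = below-unique (suc f) m n
  ... | yes _ = ++⁺ (map⁺ ∷-injectiveʳ (below-unique f (suc m) (n ∸ suc m)))
                    (below-unique (suc f) m n) disjoint
    where
    disjoint : ∀ {λs} → λs ∈ map (suc m ∷_) (partitionsBelow f (suc m) (n ∸ suc m))
                        × λs ∈ partitionsBelow (suc f) m n → ⊥
    disjoint (p , q) with ∈-map⁻ (suc m ∷_) p
    ... | _ , _ , refl with proj₁ (sound (suc f) m n q)
    ...   | m<m ∷ _ = 1+n≰n m<m

  length≤sum : ∀ {λs} → All (_≥ 1) λs → length λs ≤ sum λs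
  length≤sum [] = z≤n
  length≤sum {suc x ∷ λs} (_ ∷ pos) = s≤s (≤-trans (length≤sum pos) (m≤n+m (sum λs) x))

  bound : ∀ {λs} → Linked _≥_ λs → HeadBound (sum λs) λs
  bound []             = [-]
  bound {x ∷ λs} ps    = m≤m+n x (sum λs) ∷ ps

∈-partitions : ∀ {n λs} → λs ∈ partitions n ⇔ IsPartition n λs
∈-partitions {n} = mk⇔ to from
  where
  to : ∀ {λs} → λs ∈ partitions n → IsPartition n λs
  to p with sound n n n p
  ... | h , q = tail′ h , q

  from : ∀ {λs} → IsPartition n λs → λs ∈ partitions n
  from (dec , pos , refl) = complete n n n (length≤sum pos) (bound dec) pos refl

partitions-unique : ∀ n → Unique (partitions n)
partitions-unique n = below-unique n n n

{-# OPTIONS --safe #-}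
module Submission where

-- Let G_N(a, b) be the generating polynomial of the partitions counted by D₄ with
-- parts at most N, where a, b and q mark u, v and n.  Splitting off the largest
-- part gives recurrences for G_N, of period 8 in N, and from these
--   G_{2N}(a, b) = (1 + a q) G_{2N-3}(b q², a q²)
-- follows by induction, both sides obeying the same recurrence.  Hence the
-- generating function of D₄ satisfies G(a, b) = (1 + a q) G(b q², a q²), as does
-- the product ∏ (1 + a q^(4k+1)) (1 + b q^(4k+3)) for C₄, and this equation
-- determines all coefficients by recursion on n.
--
-- No step subtracts, so polynomials are replaced by their values at natural
-- numbers a, b and q, and coefficients are read off at the end.

open import Defs
open import Data.Bool using (false; if_then_else_; true)
open import Data.Empty using (⊥)
open import Data.List using (List; []; _++_; _∷_; filter; length; map; upTo)
open import Data.List.Membership.DecPropositional using (_∈?_)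
open import Data.List.Membership.Propositional using (_∈_)
open import Data.List.Membership.Propositional.Properties using (∈-++⁺ʳ; ∈-++⁺ˡ; ∈-++⁻; ∈-filter⁺; ∈-filter⁻; ∈-map⁺; ∈-map⁻; ∈-upTo⁺)
open import Data.List.Membership.Propositional.Properties.WithK using (unique∧set⇒bag)
open import Data.List.Properties using (filter-++; filter-all; filter-none; map-++; ∷-injectiveʳ)
open import Data.List.Relation.Binary.BagAndSetEquality using (∼bag⇒↭)
open import Data.List.Relation.Binary.Permutation.Propositional.Properties using (↭-length)
open import Data.List.Relation.Unary.All as All using (All; []; _∷_)
open import Data.List.Relation.Unary.AllPairs as AllPairs using ([]; _∷_)
open import Data.List.Relation.Unary.Any using (here)
open import Data.List.Relation.Unary.Linked as Linked using (Linked; [-]; []; _∷_)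
open import Data.List.Relation.Unary.Linked.Properties using (Linked⇒AllPairs)
open import Data.List.Relation.Unary.Unique.Propositional using (Unique)
import Data.List.Relation.Unary.Unique.Propositional.Properties as Unique
open import Data.Nat using (NonZero; _%_; _*_; _+_; _<_; _>?_; _>_; _^_; _∸_; _≟_; _≤_; _≥?_; _≥_; suc; s≤s; zero; z≤n; ℕ)
open import Data.Nat.DivMod using ([m+kn]%n≡m%n; _/_; m%n<n; m<n⇒m%n≡m; m≡m%n+[m/n]*n)
open import Data.Nat.Induction using (<-rec)
open import Data.Nat.ListAction using (sum)
open import Data.Nat.ListAction.Properties using (sum-++)
open import Data.Nat.Properties using (*-assoc; *-cancelʳ-≡; *-comm; *-distribˡ-+; *-identityʳ; *-identityˡ; *-zeroʳ; +-assoc; +-cancelˡ-≡; +-comm; +-identityʳ; +-monoˡ-≤; 1+n≰n; <-trans; <⇒≤; >⇒≢; [m+n]∸[m+o]≡n∸o; ^-*-assoc; ^-distribˡ-+-*; m+[n∸m]≡n; m+n∸m≡n; m+n≡0⇒m≡0; m∸n≢0⇒n<m; m≤m*n; m≤m+n; m≤n+m; m≤n⇒m<n∨m≡n; m≤n⇒m≤1+n; n≢0⇒n>0; n≮0; ∸-monoʳ-≤; ≤-pred; ≤-refl; ≤-trans; ≤∧≢⇒<)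
open import Data.Nat.Tactic.RingSolver using (ring; solve-∀)
open import Data.Product using (_,_; _×_; proj₁; proj₂; ∃)
open import Data.Product.Properties using (≡-dec)
open import Data.Sum using (inj₁; inj₂)
open import Data.Unit using (tt; ⊤)
open import Function using (_⇔_; _∘_; id; mk⇔; module Equivalence)
open import Level using (0ℓ)
import Relation.Binary.Definitions as Binary
open import Relation.Binary.PropositionalEquality using (_≡_; _≢_; cong; cong₂; module ≡-Reasoning; refl; subst; sym; trans)
open import Relation.Nullary using (Dec; contradiction; does; no; yes; ¬_)
open import Relation.Nullary.Decidable using (True; _×-dec_; _→-dec_; dec-false; dec-true; toWitness; ¬?)
open import Relation.Unary using (Decidable; Pred)
open import Tactic.RingSolver.Core.AlmostCommutativeRing using (module AlmostCommutativeRing)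

-- solve-∀ recognises this exponentiation, but not Data.Nat._^_.
open AlmostCommutativeRing ring using () renaming (_^_ to _^′_)

-- Coefficients of polynomials in a, b and q

private variable A B : Set

∑ : (A → ℕ) → List A → ℕ
∑ f xs = sum (map f xs)

∑-cong : {f g : A → ℕ} → (∀ x → f x ≡ g x) → ∀ xs → ∑ f xs ≡ ∑ g xs
∑-cong f≗g []       = refl
∑-cong f≗g (x ∷ xs) = cong₂ _+_ (f≗g x) (∑-cong f≗g xs)

∑-++ : (f : A → ℕ) → ∀ xs ys → ∑ f (xs ++ ys) ≡ ∑ f xs + ∑ f ys
∑-++ f xs ys = trans (cong sum (map-++ f xs ys)) (sum-++ (map f xs) (map f ys))

∑-map : (f : B → ℕ) (g : A → B) → ∀ xs → ∑ f (map g xs) ≡ ∑ (f ∘ g) xs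
∑-map f g []       = refl
∑-map f g (x ∷ xs) = cong (f (g x) +_) (∑-map f g xs)

∑-*ˡ : ∀ c (f : A → ℕ) → ∀ xs → ∑ (λ x → c * f x) xs ≡ c * ∑ f xs
∑-*ˡ c f []       = sym (*-zeroʳ c)
∑-*ˡ c f (x ∷ xs) = trans (cong (c * f x +_) (∑-*ˡ c f xs)) (sym (*-distribˡ-+ c (f x) (∑ f xs)))

∑-zero : {f : A → ℕ} → (∀ x → f x ≡ 0) → ∀ xs → ∑ f xs ≡ 0
∑-zero f≗0 []       = refl
∑-zero f≗0 (x ∷ xs) = cong₂ _+_ (f≗0 x) (∑-zero f≗0 xs)

δ : ℕ → ℕ → ℕ
δ i j = if does (i ≟ j) then 1 else 0

δ-refl : ∀ i → δ i i ≡ 1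
δ-refl i rewrite dec-true (i ≟ i) refl = refl

δ-≢ : ∀ {i j} → i ≢ j → δ i j ≡ 0
δ-≢ {i} {j} i≢j rewrite dec-false (i ≟ j) i≢j = refl

-- A polynomial in one variable is a list of terms (exponent, coefficient), unsorted and possibly
-- with repeated exponents; `coefficient` therefore adds up all terms that match.
value : List (ℕ × ℕ) → ℕ → ℕ
value xs x = ∑ (λ (e , c) → c * x ^ e) xs

coefficient : List (ℕ × ℕ) → ℕ → ℕ
coefficient xs k = ∑ (λ (e , c) → c * δ e k) xs

quotient : List (ℕ × ℕ) → List (ℕ × ℕ)
quotient []                 = []
quotient ((zero  , c) ∷ xs) = quotient xs
quotient ((suc e , c) ∷ xs) = (e , c) ∷ quotient xs

value-quotient : ∀ xs x → value xs x ≡ coefficient xs 0 + value (quotient xs) x * x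
value-quotient []                 x = refl
value-quotient ((zero  , c) ∷ xs) x = trans (cong (c * 1 +_) (value-quotient xs x))
                                            (sym (+-assoc (c * 1) _ _))
value-quotient ((suc e , c) ∷ xs) x = trans (cong (c * (x * x ^ e) +_) (value-quotient xs x))
                                            (lemma c x (x ^ e) (coefficient xs 0) (value (quotient xs) x))
  where
  lemma : ∀ c x y k v → c * (x * y) + (k + v * x) ≡ c * 0 + k + (c * y + v) * x
  lemma = solve-∀

coefficient-quotient : ∀ xs k → coefficient xs (suc k) ≡ coefficient (quotient xs) k
coefficient-quotient []                 k = refl
coefficient-quotient ((zero  , c) ∷ xs) k = cong₂ _+_ (*-zeroʳ c) (coefficient-quotient xs k)
coefficient-quotient ((suc e , c) ∷ xs) k = cong (c * δ e k +_) (coefficient-quotient xs k)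

digits-unique : ∀ {x c d p r} .{{_ : NonZero x}} → c < x → d < x → c + p * x ≡ d + r * x → c ≡ d × p ≡ r
digits-unique {x} {c} {d} {p} {r} c<x d<x eq = c≡d , *-cancelʳ-≡ p r x (+-cancelˡ-≡ d _ _ (trans (cong (_+ p * x) (sym c≡d)) eq))
  where
  c≡d : c ≡ d
  c≡d = begin
    c               ≡⟨ m<n⇒m%n≡m c<x ⟨
    c % x           ≡⟨ [m+kn]%n≡m%n c p x ⟨
    (c + p * x) % x ≡⟨ cong (_% x) eq ⟩
    (d + r * x) % x ≡⟨ [m+kn]%n≡m%n d r x ⟩
    d % x           ≡⟨ m<n⇒m%n≡m d<x ⟩
    d               ∎
    where open ≡-Reasoning

-- For `x` above both constant terms, these are the last digits in base `x` of the two equal values,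
-- hence equal, and the quotients again take equal values. Only large `x` allow this, and how large
-- changes with each division, so the hypothesis is restricted to `x` from a threshold `K` on.
coefficients-unique : ∀ K xs ys → (∀ x → K ≤ x → value xs x ≡ value ys x) →
                      ∀ k → coefficient xs k ≡ coefficient ys k
coefficients-unique K xs ys eq k = go k
  where
  -- At least `K`, so that `eq` applies, and larger than either constant term.
  K′ = suc (K + (coefficient xs 0 + coefficient ys 0))

  digits : ∀ x → K′ ≤ x → coefficient xs 0 ≡ coefficient ys 0 × value (quotient xs) x ≡ value (quotient ys) x
  digits x@(suc _) K′≤x = digits-unique
    (≤-trans (s≤s (≤-trans (m≤m+n _ _) (m≤n+m _ K))) K′≤x)
    (≤-trans (s≤s (≤-trans (m≤n+m _ (coefficient xs 0)) (m≤n+m _ K))) K′≤x)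
    (trans (sym (value-quotient xs x))
      (trans (eq x (≤-trans (m≤n⇒m≤1+n (m≤m+n K _)) K′≤x)) (value-quotient ys x)))

  go : ∀ k → coefficient xs k ≡ coefficient ys k
  go zero    = proj₁ (digits K′ ≤-refl)
  go (suc k) = begin
    coefficient xs (suc k)      ≡⟨ coefficient-quotient xs k ⟩
    coefficient (quotient xs) k ≡⟨ coefficients-unique K′ (quotient xs) (quotient ys) (λ x → proj₂ ∘ digits x) k ⟩
    coefficient (quotient ys) k ≡⟨ coefficient-quotient ys k ⟨
    coefficient ys (suc k)      ∎
    where open ≡-Reasoning

-- The coefficient `f t` may itself be a monomial in the other variables, evaluated at fixed
-- numbers. This is what lets several variables be treated one at a time.
compare-coefficients : (e f : A → ℕ) → ∀ xs ys →
                       (∀ x → ∑ (λ t → f t * x ^ e t) xs ≡ ∑ (λ t → f t * x ^ e t) ys) →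
                       ∀ k → ∑ (λ t → f t * δ (e t) k) xs ≡ ∑ (λ t → f t * δ (e t) k) ys
compare-coefficients e f xs ys eq k = begin
  ∑ (λ t → f t * δ (e t) k) xs                  ≡⟨ ∑-map _ _ xs ⟨
  coefficient (map (λ t → e t , f t) xs) k      ≡⟨ coefficients-unique 0 (map _ xs) (map _ ys)
      (λ x _ → trans (∑-map _ _ xs) (trans (eq x) (sym (∑-map _ _ ys)))) k ⟩
  coefficient (map (λ t → e t , f t) ys) k      ≡⟨ ∑-map _ _ ys ⟩
  ∑ (λ t → f t * δ (e t) k) ys                  ∎
  where open ≡-Reasoning

Exponent : Set
Exponent = ℕ × ℕ × ℕ

monomial : ℕ → ℕ → ℕ → Exponent → ℕ
monomial a b q (u , v , n) = a ^ u * b ^ v * q ^ n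

δ³ : Exponent → Exponent → ℕ
δ³ (u , v , n) (u′ , v′ , n′) = δ u u′ * δ v v′ * δ n n′

-- The exponents of `a`, `b` and `q` are compared in turn, each with the later variables still
-- evaluated. Every round replaces one power by a `δ`, and `rotate` brings the next power to the
-- last position.
polynomials-unique : ∀ ss ts → (∀ a b q → ∑ (monomial a b q) ss ≡ ∑ (monomial a b q) ts) →
                     ∀ t → ∑ (λ s → δ³ s t) ss ≡ ∑ (λ s → δ³ s t) ts
polynomials-unique ss ts eq (u , v , n) = in-q
  where
  via : {f g : Exponent → ℕ} → (∀ s → f s ≡ g s) → ∑ f ss ≡ ∑ f ts → ∑ g ss ≡ ∑ g ts
  via f≗g eq = trans (sym (∑-cong f≗g ss)) (trans eq (∑-cong f≗g ts))

  rotate : ∀ x y z → x * y * z ≡ y * z * x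
  rotate = solve-∀

  in-a : ∀ b q → ∑ (λ (u′ , v′ , n′) → b ^ v′ * q ^ n′ * δ u′ u) ss
                 ≡ ∑ (λ (u′ , v′ , n′) → b ^ v′ * q ^ n′ * δ u′ u) ts
  in-a b q = compare-coefficients proj₁ (λ (u′ , v′ , n′) → b ^ v′ * q ^ n′) ss ts
    (λ a → via (λ (u′ , v′ , n′) → rotate (a ^ u′) (b ^ v′) (q ^ n′)) (eq a b q)) u

  in-b : ∀ q → ∑ (λ (u′ , v′ , n′) → q ^ n′ * δ u′ u * δ v′ v) ss
               ≡ ∑ (λ (u′ , v′ , n′) → q ^ n′ * δ u′ u * δ v′ v) ts
  in-b q = compare-coefficients (proj₁ ∘ proj₂) (λ (u′ , v′ , n′) → q ^ n′ * δ u′ u) ss ts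
    (λ b → via (λ (u′ , v′ , n′) → rotate (b ^ v′) (q ^ n′) (δ u′ u)) (in-a b q)) v

  in-q : ∑ (λ s → δ³ s (u , v , n)) ss ≡ ∑ (λ s → δ³ s (u , v , n)) ts
  in-q = compare-coefficients (proj₂ ∘ proj₂) (λ (u′ , v′ , n′) → δ u′ u * δ v′ v) ss ts
    (λ q → via (λ (u′ , v′ , n′) → rotate (q ^ n′) (δ u′ u) (δ v′ v)) (in-b q)) n

_≟³_ : (s t : Exponent) → Dec (s ≡ t)
_≟³_ = ≡-dec _≟_ (≡-dec _≟_ _≟_)

δ³-refl : ∀ t → δ³ t t ≡ 1
δ³-refl (u , v , n) rewrite δ-refl u | δ-refl v | δ-refl n = refl

δ³-≢ : ∀ {s t} → s ≢ t → δ³ s t ≡ 0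
δ³-≢ {u , v , n} {u′ , v′ , n′} s≢t with u ≟ u′ | v ≟ v′
... | no u≢   | _       rewrite δ-≢ u≢ = refl
... | yes _    | no v≢   rewrite δ-≢ v≢ | *-zeroʳ (δ u u′) = refl
... | yes refl | yes refl with n ≟ n′
...   | no n≢    rewrite δ-≢ n≢ = *-zeroʳ (δ u u * δ v v)
...   | yes refl = contradiction refl s≢t

-- A list of exponents stands for the sum of its monomials, so this is the coefficient of the
-- monomial `t`.
multiplicity : Exponent → List Exponent → ℕ
multiplicity t = ∑ (λ s → δ³ s t)

-- The functional equation as a recursion for coefficients

module _ (φ φ⁻ : Exponent → Exponent) (φ⁻∘φ : ∀ s → φ⁻ (φ s) ≡ s) where

  δ³-injection : ∀ s t → δ³ (φ s) (φ t) ≡ δ³ s t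
  δ³-injection s t with s ≟³ t
  ... | yes refl = trans (δ³-refl (φ s)) (sym (δ³-refl s))
  ... | no s≢t   = trans (δ³-≢ (λ eq → s≢t (trans (sym (φ⁻∘φ s)) (trans (cong φ⁻ eq) (φ⁻∘φ t)))))
                         (sym (δ³-≢ s≢t))

  -- The exponent `t` has at most one preimage, namely `φ⁻ t`, and it has one exactly when
  -- `φ (φ⁻ t) ≡ t`. In that case its multiplicity is that of the preimage; otherwise it is 0 on
  -- both sides.
  multiplicity-map : ∀ t ss ts → (∀ s → φ s ≡ t → multiplicity s ss ≡ multiplicity s ts) →
                     multiplicity t (map φ ss) ≡ multiplicity t (map φ ts)
  multiplicity-map t ss ts eq with φ (φ⁻ t) ≟³ t
  ... | yes φs≡t = trans (preimage ss) (trans (eq (φ⁻ t) φs≡t) (sym (preimage ts)))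
    where
    preimage : ∀ rs → multiplicity t (map φ rs) ≡ multiplicity (φ⁻ t) rs
    preimage rs = trans (∑-map _ φ rs)
      (∑-cong (λ r → trans (cong (δ³ (φ r)) (sym φs≡t)) (δ³-injection r (φ⁻ t))) rs)
  ... | no φs≢t = trans (missed ss) (sym (missed ts))
    where
    missed : ∀ rs → multiplicity t (map φ rs) ≡ 0
    missed rs = trans (∑-map _ φ rs)
      (∑-zero (λ r → δ³-≢ (λ φr≡t → φs≢t (trans (cong φ (trans (cong φ⁻ (sym φr≡t)) (φ⁻∘φ r))) φr≡t))) rs)

-- σ acts on exponents as the substitution (a , b) ↦ (b q² , a q²), and σ′ as
-- this substitution followed by multiplication by a q.
σ σ′ σ⁻ σ′⁻ : Exponent → Exponent
σ   (u , v , n) = v , u , 2 * (u + v) + n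
σ′  (u , v , n) = suc v , u , suc (2 * (u + v) + n)
σ⁻  (u , v , n) = v , u , n ∸ 2 * (v + u)
σ′⁻ (u , v , n) = v , u ∸ 1 , n ∸ 1 ∸ 2 * (v + (u ∸ 1))

-- A left inverse is enough: where the truncated subtractions in `σ⁻` and `σ′⁻` cut off, the
-- exponent lies outside the image, which `multiplicity-map` detects.
σ⁻∘σ : ∀ s → σ⁻ (σ s) ≡ s
σ⁻∘σ (u , v , n) = cong (λ k → u , v , k) (m+n∸m≡n (2 * (u + v)) n)

σ′⁻∘σ′ : ∀ s → σ′⁻ (σ′ s) ≡ s
σ′⁻∘σ′ (u , v , n) = cong (λ k → u , v , k) (m+n∸m≡n (2 * (u + v)) n)

[m*n]^o≡m^o*n^o : ∀ m n o → (m * n) ^ o ≡ m ^ o * n ^ o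
[m*n]^o≡m^o*n^o m n zero    = refl
[m*n]^o≡m^o*n^o m n (suc o) = trans (cong (m * n *_) ([m*n]^o≡m^o*n^o m n o)) (interchange m n (m ^ o) (n ^ o))
  where
  interchange : ∀ a b c d → a * b * (c * d) ≡ a * c * (b * d)
  interchange = solve-∀

[m*[n*n]]^o≡m^o*n^[2*o] : ∀ m n o → (m * (n * n)) ^ o ≡ m ^ o * n ^ (2 * o)
[m*[n*n]]^o≡m^o*n^[2*o] m n o = trans ([m*n]^o≡m^o*n^o m (n * n) o)
  (cong (m ^ o *_) (trans (cong (_^ o) (cong (n *_) (sym (*-identityʳ n)))) (^-*-assoc n 2 o)))

monomial-σ : ∀ a b q s → monomial a b q (σ s) ≡ monomial (b * (q * q)) (a * (q * q)) q s
monomial-σ a b q (u , v , n)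
  rewrite [m*[n*n]]^o≡m^o*n^[2*o] b q u | [m*[n*n]]^o≡m^o*n^[2*o] a q v
        | ^-distribˡ-+-* q (2 * (u + v)) n | *-distribˡ-+ 2 u v | ^-distribˡ-+-* q (2 * u) (2 * v)
  = lemma (a ^ v) (b ^ u) (q ^ (2 * u)) (q ^ (2 * v)) (q ^ n)
  where
  lemma : ∀ x y z w t → x * y * (z * w * t) ≡ y * z * (x * w) * t
  lemma = solve-∀

monomial-σ′ : ∀ a b q s → monomial a b q (σ′ s) ≡ a * q * monomial a b q (σ s)
monomial-σ′ a b q (u , v , n) = lemma a (a ^ v) (b ^ u) q (q ^ (2 * (u + v) + n))
  where
  lemma : ∀ x y z w t → x * y * z * (w * t) ≡ x * w * (y * z * t)
  lemma = solve-∀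

-- The functional equation G(a, b) = (1 + a q) G(b q², a q²) for the generating
-- function of f, as an identity of polynomials that agree with it up to q^N.
record Functional (f : Exponent → ℕ) : Set where
  field
    initial    : ∀ n → f (0 , 0 , n) ≡ δ 0 n
    lhs rhs    : ℕ → List Exponent
    lhs-f      : ∀ {N} u v n → n ≤ N → multiplicity (u , v , n) (lhs N) ≡ f (u , v , n)
    rhs-f      : ∀ {N} u v n → n ≤ N → multiplicity (u , v , n) (rhs N) ≡ f (u , v , n)
    functional : ∀ N a b q → ∑ (monomial a b q) (lhs N)
                 ≡ (1 + a * q) * ∑ (monomial (b * (q * q)) (a * (q * q)) q) (rhs N)

  -- Distributing `1 + a * q` turns the right side of `functional` into the monomials of `map σ` and
  -- `map σ′`, and `polynomials-unique` compares coefficients.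
  recursion : ∀ {N} u v n → n ≤ N →
              f (u , v , n) ≡ multiplicity (u , v , n) (map σ (rhs N)) + multiplicity (u , v , n) (map σ′ (rhs N))
  recursion {N} u v n n≤N = begin
    f (u , v , n)                                                        ≡⟨ lhs-f u v n n≤N ⟨
    multiplicity (u , v , n) (lhs N)                                     ≡⟨ polynomials-unique (lhs N) (map σ (rhs N) ++ _) eq _ ⟩
    multiplicity (u , v , n) (map σ (rhs N) ++ map σ′ (rhs N))           ≡⟨ ∑-++ _ (map σ (rhs N)) _ ⟩
    multiplicity (u , v , n) (map σ (rhs N)) + multiplicity (u , v , n) (map σ′ (rhs N)) ∎
    where
    open ≡-Reasoning
    eq : ∀ a b q → ∑ (monomial a b q) (lhs N) ≡ ∑ (monomial a b q) (map σ (rhs N) ++ map σ′ (rhs N))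
    eq a b q = begin
      ∑ (monomial a b q) (lhs N)
        ≡⟨ functional N a b q ⟩
      S + a * q * S
        ≡⟨ cong₂ _+_ (∑-cong (monomial-σ a b q) (rhs N))
             (trans (∑-cong (λ s → trans (monomial-σ′ a b q s) (cong (a * q *_) (monomial-σ a b q s))) (rhs N))
                    (∑-*ˡ (a * q) _ (rhs N))) ⟨
      ∑ (monomial a b q ∘ σ) (rhs N) + ∑ (monomial a b q ∘ σ′) (rhs N)
        ≡⟨ cong₂ _+_ (∑-map _ σ (rhs N)) (∑-map _ σ′ (rhs N)) ⟨
      ∑ (monomial a b q) (map σ (rhs N)) + ∑ (monomial a b q) (map σ′ (rhs N))
        ≡⟨ ∑-++ _ (map σ (rhs N)) _ ⟨
      ∑ (monomial a b q) (map σ (rhs N) ++ map σ′ (rhs N)) ∎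
      where S = ∑ (monomial (b * (q * q)) (a * (q * q)) q) (rhs N)

module _ {f g : Exponent → ℕ} (F : Functional f) (G : Functional g) where
  private
    module F = Functional F
    module G = Functional G

  -- Strong induction on `n`: `σ` raises the last component by `2 * (u + v)` and `σ′` by one more,
  -- so the recursion refers to smaller `n` only. The exception is `u = v = 0`, where `σ` fixes the
  -- exponent and `initial` supplies the value.
  functional-unique : ∀ n u v → f (u , v , n) ≡ g (u , v , n)
  functional-unique = <-rec _ λ n rec → λ where
      zero    zero    → trans (F.initial n) (sym (G.initial n))
      u@zero    v@(suc _) → step n rec u v λ ()
      u@(suc _) v         → step n rec u v λ ()
    where
    step : ∀ n → (∀ {m} → m < n → ∀ u v → f (u , v , m) ≡ g (u , v , m)) →
           ∀ u v → u + v ≢ 0 → f (u , v , n) ≡ g (u , v , n)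
    step n rec u v u+v≢0 = begin
      f (u , v , n)
        ≡⟨ F.recursion u v n ≤-refl ⟩
      multiplicity (u , v , n) (map σ (F.rhs n)) + multiplicity (u , v , n) (map σ′ (F.rhs n))
        ≡⟨ cong₂ _+_ (multiplicity-map σ σ⁻ σ⁻∘σ _ (F.rhs n) (G.rhs n) below)
                     (multiplicity-map σ′ σ′⁻ σ′⁻∘σ′ _ (F.rhs n) (G.rhs n) below′) ⟩
      multiplicity (u , v , n) (map σ (G.rhs n)) + multiplicity (u , v , n) (map σ′ (G.rhs n))
        ≡⟨ G.recursion u v n ≤-refl ⟨
      g (u , v , n) ∎
      where
      open ≡-Reasoning

      smaller : ∀ s → proj₂ (proj₂ s) < n → multiplicity s (F.rhs n) ≡ multiplicity s (G.rhs n)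
      smaller (u′ , v′ , n′) n′<n = trans (F.rhs-f u′ v′ n′ (<⇒≤ n′<n))
        (trans (rec n′<n u′ v′) (sym (G.rhs-f u′ v′ n′ (<⇒≤ n′<n))))

      below : ∀ s → σ s ≡ (u , v , n) → multiplicity s (F.rhs n) ≡ multiplicity s (G.rhs n)
      below s@(u′ , v′ , n′) refl = smaller s (+-monoˡ-≤ n′ (positive u′ v′ (u+v≢0 ∘ trans (+-comm v′ u′))))
        where
        positive : ∀ i j → i + j ≢ 0 → 1 ≤ 2 * (i + j)
        positive i j i+j≢0 = ≤-trans (n≢0⇒n>0 i+j≢0) (m≤m+n _ _)

      below′ : ∀ s → σ′ s ≡ (u , v , n) → multiplicity s (F.rhs n) ≡ multiplicity s (G.rhs n)
      below′ s@(u′ , v′ , n′) refl = smaller s (s≤s (m≤n+m n′ _))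

-- Weights of partitions and enumeration by largest part

-- These weights of the `D₄` side serve `C₄` as well: by `odd-parts` they agree on its partitions
-- with the counts of residues 1 and 3 modulo 4.
U V : List ℕ → ℕ
U λs = #parts (0 ∷ 1 ∷ []) 4 λs + 2 * #parts (6 ∷ []) 8 λs
V λs = #parts (0 ∷ 3 ∷ []) 4 λs + 2 * #parts (2 ∷ []) 8 λs

exponent : List ℕ → Exponent
exponent λs = U λs , V λs , sum λs

weight : ℕ → ℕ → ℕ → List ℕ → ℕ
weight a b q λs = monomial a b q (exponent λs)

#parts-∷ : ∀ rs m .{{_ : NonZero m}} x λs → #parts rs m (x ∷ λs) ≡ #parts rs m (x ∷ []) + #parts rs m λs
#parts-∷ rs m x λs with does (≅? rs m x)
... | true  = refl
... | false = refl

#parts-≡ : ∀ rs m .{{_ : NonZero m}} x y → x % m ≡ y % m → #parts rs m (x ∷ []) ≡ #parts rs m (y ∷ [])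
#parts-≡ rs m x y eq with does (≅? rs m x) | does (≅? rs m y) | cong (λ r → does (_∈?_ _≟_ r rs)) eq
... | true  | true  | _ = refl
... | false | false | _ = refl

U-∷ : ∀ x λs → U (x ∷ λs) ≡ U (x ∷ []) + U λs
U-∷ x λs rewrite #parts-∷ (0 ∷ 1 ∷ []) 4 x λs | #parts-∷ (6 ∷ []) 8 x λs =
  lemma (#parts (0 ∷ 1 ∷ []) 4 (x ∷ [])) (#parts (6 ∷ []) 8 (x ∷ []))
        (#parts (0 ∷ 1 ∷ []) 4 λs) (#parts (6 ∷ []) 8 λs)
  where
  lemma : ∀ i j k l → i + k + 2 * (j + l) ≡ i + 2 * j + (k + 2 * l)
  lemma = solve-∀

V-∷ : ∀ x λs → V (x ∷ λs) ≡ V (x ∷ []) + V λs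
V-∷ x λs rewrite #parts-∷ (0 ∷ 3 ∷ []) 4 x λs | #parts-∷ (2 ∷ []) 8 x λs =
  lemma (#parts (0 ∷ 3 ∷ []) 4 (x ∷ [])) (#parts (2 ∷ []) 8 (x ∷ []))
        (#parts (0 ∷ 3 ∷ []) 4 λs) (#parts (2 ∷ []) 8 λs)
  where
  lemma : ∀ i j k l → i + k + 2 * (j + l) ≡ i + 2 * j + (k + 2 * l)
  lemma = solve-∀

weight-∷ : ∀ a b q x λs → weight a b q (x ∷ λs) ≡ weight a b q (x ∷ []) * weight a b q λs
weight-∷ a b q x λs
  rewrite U-∷ x λs | V-∷ x λs | +-identityʳ x
        | ^-distribˡ-+-* a (U (x ∷ [])) (U λs) | ^-distribˡ-+-* b (V (x ∷ [])) (V λs) | ^-distribˡ-+-* q x (sum λs) =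
  lemma (a ^ U (x ∷ [])) (a ^ U λs) (b ^ V (x ∷ [])) (b ^ V λs) (q ^ x) (q ^ sum λs)
  where
  lemma : ∀ i j k l m n → i * j * (k * l) * (m * n) ≡ i * k * m * (j * l * n)
  lemma = solve-∀

[r+m*8]%4≡r%4 : ∀ r m → (r + m * 8) % 4 ≡ r % 4
[r+m*8]%4≡r%4 r m = trans (cong (λ k → (r + k) % 4) (sym (*-assoc m 2 4))) ([m+kn]%n≡m%n r (m * 2) 4)

U-periodic : ∀ r m → U (r + m * 8 ∷ []) ≡ U (r ∷ [])
U-periodic r m = cong₂ (λ i j → i + 2 * j) (#parts-≡ (0 ∷ 1 ∷ []) 4 (r + m * 8) r ([r+m*8]%4≡r%4 r m))
                                           (#parts-≡ (6 ∷ []) 8 (r + m * 8) r ([m+kn]%n≡m%n r m 8))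

V-periodic : ∀ r m → V (r + m * 8 ∷ []) ≡ V (r ∷ [])
V-periodic r m = cong₂ (λ i j → i + 2 * j) (#parts-≡ (0 ∷ 3 ∷ []) 4 (r + m * 8) r ([r+m*8]%4≡r%4 r m))
                                           (#parts-≡ (2 ∷ []) 8 (r + m * 8) r ([m+kn]%n≡m%n r m 8))

weight-periodic : ∀ a b q r m →
                  weight a b q (r + m * 8 ∷ []) ≡ monomial a b q (U (r ∷ []) , V (r ∷ []) , r) * q ^ (m * 8)
weight-periodic a b q r m
  rewrite U-periodic r m | V-periodic r m | +-identityʳ (r + m * 8) | ^-distribˡ-+-* q r (m * 8)
  = sym (*-assoc (a ^ U (r ∷ []) * b ^ V (r ∷ [])) (q ^ r) (q ^ (m * 8)))

^≡^′ : ∀ x n → x ^ n ≡ x ^′ n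
^≡^′ x zero          = refl
^≡^′ x (suc zero)    = *-identityʳ x
^≡^′ x (suc (suc n)) = trans (cong (x *_) (^≡^′ x (suc n))) (*-comm x (x ^′ suc n))

weight-part : ∀ a b q r m {w} → a ^′ U (r ∷ []) * b ^′ V (r ∷ []) ≡ w →
              weight a b q (r + m * 8 ∷ []) ≡ w * q ^′ r * q ^ (m * 8)
weight-part a b q r m eq = trans (weight-periodic a b q r m) (cong (_* q ^ (m * 8))
  (cong₂ _*_ (trans (cong₂ _*_ (^≡^′ a (U (r ∷ []))) (^≡^′ b (V (r ∷ [])))) eq) (^≡^′ q r)))

-- The implicit `True` argument decides the residues 0 to 7 by evaluation; `shift` carries the
-- result to all numbers.
mod-8-induction : {P : ℕ → Set} → (∀ r m → P r → P (r + m * 8)) →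
                  (P? : Decidable P) → {True (All.all? P? (upTo 8))} → ∀ x → P x
mod-8-induction {P} shift P? {all} x = subst P (sym (m≡m%n+[m/n]*n x 8))
  (shift (x % 8) (x / 8) (All.lookup (toWitness all) (∈-upTo⁺ (m%n<n x 8))))

-- Every part contributes to `U` or to `V`, so the empty partition alone has both weights 0.
U+V≢0 : ∀ x → ¬ (U (x ∷ []) ≡ 0 × V (x ∷ []) ≡ 0)
U+V≢0 = mod-8-induction
  (λ r m p (U≡0 , V≡0) → p (trans (sym (U-periodic r m)) U≡0 , trans (sym (V-periodic r m)) V≡0))
  (λ r → ¬? (U (r ∷ []) ≟ 0 ×-dec V (r ∷ []) ≟ 0))

unique-set⇒length : {A : Set} {xs ys : List A} → Unique xs → Unique ys →
                    (∀ {x} → x ∈ xs ⇔ x ∈ ys) → length xs ≡ length ys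
unique-set⇒length xs! ys! xs∼ys = ↭-length (∼bag⇒↭ (unique∧set⇒bag xs! ys! xs∼ys))

length-filter-≟³ : {A : Set} (e : A → Exponent) (t : Exponent) → ∀ xs →
                   length (filter (λ x → e x ≟³ t) xs) ≡ multiplicity t (map e xs)
length-filter-≟³ e t []       = refl
length-filter-≟³ e t (x ∷ xs) with e x ≟³ t
... | yes ex≡t = cong₂ _+_ (sym (trans (cong (λ s → δ³ s t) ex≡t) (δ³-refl t))) (length-filter-≟³ e t xs)
... | no  ex≢t = cong₂ _+_ (sym (δ³-≢ ex≢t)) (length-filter-≟³ e t xs)

-- One construction for both sides: `R` restricts consecutive parts and `S` single parts. Since `R`
-- forces strict decrease, what follows a largest part `suc k` is already in `enumerate k`.
module Enumeration
  {R : ℕ → ℕ → Set} (R? : Binary.Decidable R) (R⇒> : ∀ {x y} → R x y → y < x)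
  {S : ℕ → Set} (S? : Decidable S) where

  Fits : ℕ → List ℕ → Set
  Fits k []      = ⊤
  Fits k (x ∷ _) = R k x

  fits? : ∀ k → Decidable (Fits k)
  fits? k []      = yes tt
  fits? k (x ∷ _) = R? k x

  extend : ℕ → List (List ℕ) → List (List ℕ)
  extend k L = if does (S? k) then map (k ∷_) (filter (fits? k) L) else []

  enumerate : ℕ → List (List ℕ)
  enumerate zero    = [] ∷ []
  enumerate (suc k) = enumerate k ++ extend (suc k) (enumerate k)

  Bounded : ℕ → List ℕ → Set
  Bounded N []      = ⊤
  Bounded N (x ∷ _) = x ≤ N

  Admissible : List ℕ → Set
  Admissible λs = Linked R λs × All S λs × All (_≥ 1) λs

  ∈-extend⁻ : ∀ k L {λs} → λs ∈ extend k L → S k × ∃ λ μs → μs ∈ L × Fits k μs × λs ≡ k ∷ μs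
  ∈-extend⁻ k L λs∈ with S? k
  ... | no _ = contradiction λs∈ λ ()
  ... | yes Sk with ∈-map⁻ (k ∷_) λs∈
  ...   | μs , μs∈ , refl with ∈-filter⁻ (fits? k) μs∈
  ...     | μs∈L , fits = Sk , μs , μs∈L , fits , refl

  ∈-extend⁺ : ∀ k L {λs} → S k → λs ∈ L → Fits k λs → (k ∷ λs) ∈ extend k L
  ∈-extend⁺ k L Sk λs∈ fits with S? k
  ... | no ¬Sk = contradiction Sk ¬Sk
  ... | yes _  = ∈-map⁺ (k ∷_) (∈-filter⁺ (fits? k) λs∈ fits)

  Fits⇒Linked : ∀ {k} λs → Fits k λs → Linked R λs → Linked R (k ∷ λs)
  Fits⇒Linked []       _   _  = [-]
  Fits⇒Linked (x ∷ λs) Rkx ps = Rkx ∷ ps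

  Linked⇒Fits : ∀ {k λs} → Linked R (k ∷ λs) → Fits k λs × Linked R λs
  Linked⇒Fits [-]        = tt , []
  Linked⇒Fits (Rkx ∷ ps) = Rkx , ps

  Bounded-suc : ∀ {N} λs → Bounded N λs → Bounded (suc N) λs
  Bounded-suc []      _   = tt
  Bounded-suc (x ∷ _) x≤N = m≤n⇒m≤1+n x≤N

  Fits⇒Bounded : ∀ {N} λs → Fits (suc N) λs → Bounded N λs
  Fits⇒Bounded []      _ = tt
  Fits⇒Bounded (x ∷ _) R = ≤-pred (R⇒> R)

  enumerate-sound : ∀ N {λs} → λs ∈ enumerate N → Admissible λs × Bounded N λs
  enumerate-sound zero (here refl) = ([] , [] , []) , tt
  enumerate-sound (suc N) {λs} λs∈ with ∈-++⁻ (enumerate N) λs∈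
  ... | inj₁ λs∈N with enumerate-sound N λs∈N
  ...   | adm , bd = adm , Bounded-suc λs bd
  enumerate-sound (suc N) λs∈ | inj₂ λs∈ext with ∈-extend⁻ (suc N) (enumerate N) λs∈ext
  ... | Sk , μs , μs∈ , fits , refl with enumerate-sound N μs∈
  ...   | (ps , Ss , pos) , _ = (Fits⇒Linked μs fits ps , Sk ∷ Ss , s≤s z≤n ∷ pos) , ≤-refl

  enumerate-complete : ∀ N {λs} → Admissible λs → Bounded N λs → λs ∈ enumerate N
  enumerate-complete zero {[]} _ _ = here refl
  enumerate-complete zero {zero ∷ _} (_ , _ , () ∷ _) _
  enumerate-complete (suc N) {[]} adm bd = ∈-++⁺ˡ (enumerate-complete N adm tt)
  enumerate-complete (suc N) {x ∷ λs} adm x≤ with m≤n⇒m<n∨m≡n x≤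
  ... | inj₁ (s≤s x≤N) = ∈-++⁺ˡ (enumerate-complete N adm x≤N)
  enumerate-complete (suc N) {_ ∷ λs} (ps , Sk ∷ Ss , _ ∷ pos) _ | inj₂ refl with Linked⇒Fits ps
  ... | fits , ps′ = ∈-++⁺ʳ (enumerate N)
    (∈-extend⁺ (suc N) (enumerate N) Sk (enumerate-complete N (ps′ , Ss , pos) (Fits⇒Bounded λs fits)) fits)

  extend-unique : ∀ k {L} → Unique L → Unique (extend k L)
  extend-unique k L! with does (S? k)
  ... | true  = Unique.map⁺ ∷-injectiveʳ (Unique.filter⁺ (fits? k) L!)
  ... | false = []

  enumerate-unique : ∀ N → Unique (enumerate N)
  enumerate-unique zero    = [] ∷ []
  enumerate-unique (suc N) = Unique.++⁺ (enumerate-unique N) (extend-unique (suc N) (enumerate-unique N)) disjoint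
    where
    disjoint : ∀ {λs} → λs ∈ enumerate N × λs ∈ extend (suc N) (enumerate N) → ⊥
    disjoint (p , p′) with ∈-extend⁻ (suc N) (enumerate N) p′
    ... | _ , _ , _ , _ , refl = 1+n≰n (proj₂ (enumerate-sound N p))

  exponents : ℕ → List Exponent
  exponents N = map exponent (enumerate N)

  bounded-sum : ∀ λs {N} → sum λs ≤ N → Bounded N λs
  bounded-sum []       _ = tt
  bounded-sum (x ∷ λs) p = ≤-trans (m≤m+n x (sum λs)) p

  -- Both `partitions n` and `enumerate N` are free of repetitions, so after filtering it suffices
  -- that they have the same elements. With `n ≤ N` no partition of `n` has a part too large to be
  -- enumerated.
  #partitions-exponents : ∀ {P : Pred (List ℕ) 0ℓ} (P? : Decidable P) {N} u v n → n ≤ N →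
    (∀ {λs} → (IsPartition n λs × P λs) ⇔ (Admissible λs × exponent λs ≡ (u , v , n))) →
    multiplicity (u , v , n) (exponents N) ≡ #partitions P? n
  #partitions-exponents P? {N} u v n n≤N P⇔ = trans (sym (length-filter-≟³ exponent (u , v , n) (enumerate N)))
    (sym (unique-set⇒length (Unique.filter⁺ P? (partitions-unique n))
                            (Unique.filter⁺ (λ λs → exponent λs ≟³ _) (enumerate-unique N))
      (mk⇔ to from)))
    where
    to : ∀ {λs} → λs ∈ filter P? (partitions n) → λs ∈ filter (λ λs → exponent λs ≟³ (u , v , n)) (enumerate N)
    to {λs} λs∈ with ∈-filter⁻ P? λs∈
    ... | λs∈′ , Pλs with Equivalence.to P⇔ (Equivalence.to ∈-partitions λs∈′ , Pλs)
    ...   | adm , eq = ∈-filter⁺ (λ λs → exponent λs ≟³ _)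
      (enumerate-complete N adm (bounded-sum λs (subst (_≤ N) (sym (cong (proj₂ ∘ proj₂) eq)) n≤N))) eq

    from : ∀ {λs} → λs ∈ filter (λ λs → exponent λs ≟³ (u , v , n)) (enumerate N) → λs ∈ filter P? (partitions n)
    from λs∈ with ∈-filter⁻ (λ λs → exponent λs ≟³ _) {xs = enumerate N} λs∈
    ... | λs∈′ , eq with Equivalence.from P⇔ (proj₁ (enumerate-sound N λs∈′) , eq)
    ...   | part , Pλs = ∈-filter⁺ P? (Equivalence.from ∈-partitions part) Pλs

  -- By `U+V≢0` no nonempty partition counts, and the empty one enters only through
  -- `enumerate zero`.
  multiplicity-00 : ∀ N n → multiplicity (0 , 0 , n) (exponents N) ≡ δ 0 n
  multiplicity-00 zero    n = trans (+-identityʳ _) (+-identityʳ _)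
  multiplicity-00 (suc N) n = begin
    multiplicity t (map exponent (enumerate N ++ E))        ≡⟨ cong (multiplicity t) (map-++ exponent (enumerate N) E) ⟩
    multiplicity t (exponents N ++ map exponent E)          ≡⟨ ∑-++ _ (exponents N) _ ⟩
    multiplicity t (exponents N) + multiplicity t (map exponent E) ≡⟨ cong₂ _+_ (multiplicity-00 N n) extended ⟩
    δ 0 n + 0                                               ≡⟨ +-identityʳ _ ⟩
    δ 0 n                                                   ∎
    where
    open ≡-Reasoning
    t = (0 , 0 , n)
    E = extend (suc N) (enumerate N)

    nonzero : ∀ μs → δ³ (exponent (suc N ∷ μs)) t ≡ 0
    nonzero μs = δ³-≢ {exponent (suc N ∷ μs)} {t} λ eq → U+V≢0 (suc N)
      ( m+n≡0⇒m≡0 _ (trans (sym (U-∷ (suc N) μs)) (cong proj₁ eq))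
      , m+n≡0⇒m≡0 _ (trans (sym (V-∷ (suc N) μs)) (cong (proj₁ ∘ proj₂) eq)))

    extended : multiplicity t (map exponent E) ≡ 0
    extended with does (S? (suc N))
    ... | false = refl
    ... | true  = trans (∑-map (λ s → δ³ s t) exponent (map (suc N ∷_) L))
                    (trans (∑-map (λ λs → δ³ (exponent λs) t) (suc N ∷_) L) (∑-zero nonzero L))
      where L = filter (fits? (suc N)) (enumerate N)

  module Generating (a b q : ℕ) where
    gen : ℕ → ℕ
    gen N = ∑ (weight a b q) (enumerate N)

    genFits : ℕ → ℕ → ℕ
    genFits k j = ∑ (weight a b q) (filter (fits? k) (enumerate j))

    genLargest : ℕ → ℕ
    genLargest zero    = 0
    genLargest (suc k) = if does (S? (suc k)) then weight a b q (suc k ∷ []) * genFits (suc k) k else 0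

    ∑-extend : ∀ k → ∑ (weight a b q) (extend (suc k) (enumerate k)) ≡ genLargest (suc k)
    ∑-extend k with does (S? (suc k))
    ... | false = refl
    ... | true  = trans (∑-map _ (suc k ∷_) L)
                    (trans (∑-cong (weight-∷ a b q (suc k)) L) (∑-*ˡ (weight a b q (suc k ∷ [])) (weight a b q) L))
      where L = filter (fits? (suc k)) (enumerate k)

    gen-suc : ∀ k → gen (suc k) ≡ gen k + genLargest (suc k)
    gen-suc k = trans (∑-++ _ (enumerate k) _) (cong (gen k +_) (∑-extend k))

    extend-heads : ∀ k L → All (λ λs → ∃ λ μs → λs ≡ k ∷ μs) (extend k L)
    extend-heads k L = All.tabulate λ λs∈ → let _ , μs , _ , _ , eq = ∈-extend⁻ k L λs∈ in μs , eq

    -- Fitting depends on the largest part alone, so the partitions with largest part `suc j` are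
    -- kept or dropped together.
    genFits-suc : ∀ k j → genFits k (suc j)
                  ≡ (if does (R? k (suc j)) then genFits k j + genLargest (suc j) else genFits k j)
    genFits-suc k j = trans (cong (∑ (weight a b q)) (filter-++ (fits? k) (enumerate j) E))
                            (trans (∑-++ _ (filter (fits? k) (enumerate j)) _) new)
      where
      E     = extend (suc j) (enumerate j)
      heads = extend-heads (suc j) (enumerate j)

      new : genFits k j + ∑ (weight a b q) (filter (fits? k) E)
            ≡ (if does (R? k (suc j)) then genFits k j + genLargest (suc j) else genFits k j)
      new with R? k (suc j)
      ... | yes r = cong (genFits k j +_)
        (trans (cong (∑ (weight a b q)) (filter-all (fits? k) (All.map (λ { (_ , refl) → r }) heads))) (∑-extend j))
      ... | no ¬r = trans
        (cong (λ L → genFits k j + ∑ (weight a b q) L) (filter-none (fits? k) (All.map (λ { (_ , refl) → ¬r }) heads)))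
        (+-identityʳ _)

    genFits-all : ∀ k j → (∀ {i} → i ≤ j → R k i) → genFits k j ≡ gen j
    genFits-all k zero    _  = refl
    genFits-all k (suc j) Rk with R? k (suc j) | genFits-suc k j
    ... | yes _ | eq = trans eq (trans (cong (_+ genLargest (suc j)) (genFits-all k j (Rk ∘ m≤n⇒m≤1+n))) (sym (gen-suc j)))
    ... | no ¬r | _  = contradiction (Rk ≤-refl) ¬r

    ∑-exponents : ∀ N → ∑ (monomial a b q) (exponents N) ≡ gen N
    ∑-exponents N = ∑-map _ exponent (enumerate N)

    genLargest-excluded : ∀ k → does (S? (suc k)) ≡ false → genLargest (suc k) ≡ 0
    genLargest-excluded k ¬S rewrite ¬S = refl

    -- The powers of `a` and `b` depend only on the residue modulo 8 and are evaluated at `suc k`;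
    -- the period contributes just `q ^ (m * 8)`.
    genLargest-periodic : ∀ k m {w x} → does (S? (suc k + m * 8)) ≡ true →
                          a ^′ U (suc k ∷ []) * b ^′ V (suc k ∷ []) ≡ w →
                          genFits (suc k + m * 8) (k + m * 8) ≡ x →
                          genLargest (suc k + m * 8) ≡ w * q ^′ suc k * q ^ (m * 8) * x
    genLargest-periodic k m Sk eq₁ eq₂ = trans unfold (cong₂ _*_ (weight-part a b q (suc k) m eq₁) eq₂)
      where
      unfold : genLargest (suc k + m * 8) ≡ weight a b q (suc k + m * 8 ∷ []) * genFits (suc k + m * 8) (k + m * 8)
      unfold rewrite Sk = refl

    gen-step : ∀ k {x y} → gen k ≡ x → genLargest (suc k) ≡ y → gen (suc k) ≡ x + y
    gen-step k eq₁ eq₂ = trans (gen-suc k) (cong₂ _+_ eq₁ eq₂)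

-- Partitions counted by D₄

-- Gap x y is definitionally Gap′ (x ∸ y) (x % 8), so that gap? can be evaluated at
-- x = r + 8 m and y = c + 8 m once the difference and the residue are rewritten to literals.
Gap′ : ℕ → ℕ → Set
Gap′ d r =
    d ≥ 5
  × (d ≡ 5 → r ∈ 1 ∷ 4 ∷ [])
  × (d ≡ 6 → r ∈ 1 ∷ 3 ∷ 5 ∷ 7 ∷ [])
  × (d ≡ 7 → r ∈ 0 ∷ 1 ∷ 3 ∷ 4 ∷ 6 ∷ 7 ∷ [])
  × (d ≡ 8 → r ∈ 0 ∷ 1 ∷ 3 ∷ 4 ∷ 5 ∷ 7 ∷ [])

gap′? : ∀ d r → Dec (Gap′ d r)
gap′? d r =
    (d ≥? 5)
  ×-dec ((d ≟ 5) →-dec _∈?_ _≟_ r _)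
  ×-dec ((d ≟ 6) →-dec _∈?_ _≟_ r _)
  ×-dec ((d ≟ 7) →-dec _∈?_ _≟_ r _)
  ×-dec ((d ≟ 8) →-dec _∈?_ _≟_ r _)

gap′ : ∀ d r → {True (gap′? d r)} → Gap′ d r
gap′ d r {p} = toWitness p

Gap⇒> : ∀ {x y} → Gap x y → y < x
Gap⇒> {x} {y} (x∸y≥5 , _) = m∸n≢0⇒n<m {x} {y} λ eq → n≮0 (subst (5 ≤_) eq x∸y≥5)

-- Beyond a difference of 8 no residue condition is left. The lemmas that follow lower the threshold
-- one difference at a time, down to the least one that the residue admits without exception.
Gap′-≥9 : ∀ d r → Gap′ (9 + d) r
Gap′-≥9 d r = s≤s (s≤s (s≤s (s≤s (s≤s z≤n)))) , (λ ()) , (λ ()) , (λ ()) , (λ ())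

Gap′-≥8 : ∀ r → Gap′ 8 r → ∀ d → Gap′ (8 + d) r
Gap′-≥8 r p zero    = p
Gap′-≥8 r p (suc d) = Gap′-≥9 d r

Gap′-≥7 : ∀ r → Gap′ 7 r → Gap′ 8 r → ∀ d → Gap′ (7 + d) r
Gap′-≥7 r p p′ zero    = p
Gap′-≥7 r p p′ (suc d) = Gap′-≥8 r p′ d

Gap′-≥6 : ∀ r → Gap′ 6 r → Gap′ 7 r → Gap′ 8 r → ∀ d → Gap′ (6 + d) r
Gap′-≥6 r p p′ p″ zero    = p
Gap′-≥6 r p p′ p″ (suc d) = Gap′-≥7 r p′ p″ d

Gap′-≥5 : ∀ r → Gap′ 5 r → Gap′ 6 r → Gap′ 7 r → Gap′ 8 r → ∀ d → Gap′ (5 + d) r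
Gap′-≥5 r p p′ p″ p‴ zero    = p
Gap′-≥5 r p p′ p″ p‴ (suc d) = Gap′-≥6 r p′ p″ p‴ d

[m+o]∸[n+o]≡m∸n : ∀ m n o → m + o ∸ (n + o) ≡ m ∸ n
[m+o]∸[n+o]≡m∸n m n o = trans (cong₂ _∸_ (+-comm m o) (+-comm n o)) ([m+n]∸[m+o]≡n∸o o m n)

≢2? : Decidable (_≢ 2)
≢2? x = ¬? (x ≟ 2)

module 𝔻 = Enumeration gap? Gap⇒> ≢2?

module D-generating (a b q : ℕ) where
  open 𝔻.Generating a b q public

  -- The value of genFits (r + 8 m) (n + c + 8 m) when all parts up to c + 8 m may follow r + 8 m.
  fitting : (r c m n : ℕ) → ℕ
  fitting r c m zero    = gen (c + m * 8)
  fitting r c m (suc n) =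
    if does (gap′? (r ∸ suc (n + c)) (r % 8))
    then fitting r c m n + genLargest (suc (n + c) + m * 8)
    else fitting r c m n

  -- Shifting both parts by `m * 8` changes neither their difference nor the residue, so every test
  -- becomes one on literals and `fitting` evaluates for numerals `r`, `c` and `n`.
  genFits-fitting : ∀ r c m n → genFits (r + m * 8) (c + m * 8) ≡ gen (c + m * 8) →
                    genFits (r + m * 8) (n + c + m * 8) ≡ fitting r c m n
  genFits-fitting r c m zero    eq = eq
  genFits-fitting r c m (suc n) eq = trans (genFits-suc (r + m * 8) (n + c + m * 8))
    (cong₂ (λ p x → if p then x + genLargest (suc (n + c) + m * 8) else x)
      (cong₂ (λ d s → does (gap′? d s)) ([m+o]∸[n+o]≡m∸n r (suc (n + c)) (m * 8)) ([m+kn]%n≡m%n r m 8))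
      (genFits-fitting r c m n eq))

  genFits-periodic : ∀ r c → (∀ d → Gap′ (r ∸ c + d) (r % 8)) → ∀ n m →
                     genFits (r + m * 8) (n + c + m * 8) ≡ fitting r c m n
  genFits-periodic r c gaps n m = genFits-fitting r c m n (genFits-all (r + m * 8) (c + m * 8) λ {i} i≤ →
      subst (Gap′ (r + m * 8 ∸ i)) (sym ([m+kn]%n≡m%n r m 8))
        (subst (λ d → Gap′ d (r % 8)) (m+[n∸m]≡n (difference i≤)) (gaps _)))
    where
    difference : ∀ {i} → i ≤ c + m * 8 → r ∸ c ≤ r + m * 8 ∸ i
    difference {i} i≤ = subst (_≤ r + m * 8 ∸ i) ([m+o]∸[n+o]≡m∸n r c (m * 8)) (∸-monoʳ-≤ (r + m * 8) i≤)

  -- What may follow each of the parts 4 + 8 m, 5 + 8 m and 6 + 8 m.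
  following : ℕ → ℕ
  following zero    = 1
  following (suc m) = gen (5 + m * 8) + genLargest (7 + m * 8)

  weight-a : a * 1 ≡ a
  weight-a = *-identityʳ a

  weight-b : 1 * b ≡ b
  weight-b = *-identityˡ b

  -- The parts 12, 13 and 14 (plus `m * 8`) admit the same followers: everything up to 5, and 7, but
  -- neither 6 nor anything from 8 on. Nothing can follow 4, 5 or 6 themselves.
  fits₄ : ∀ m → genFits (4 + m * 8) (3 + m * 8) ≡ following m
  fits₄ zero    = genFits-fitting 4 0 0 3 refl
  fits₄ (suc m) = genFits-periodic 12 5 (Gap′-≥7 4 (gap′ 7 4) (gap′ 8 4)) 6 m

  fits₅ : ∀ m → genFits (5 + m * 8) (4 + m * 8) ≡ following m
  fits₅ zero    = genFits-fitting 5 0 0 4 refl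
  fits₅ (suc m) = genFits-periodic 13 5 (Gap′-≥8 5 (gap′ 8 5)) 7 m

  fits₆ : ∀ m → genFits (6 + m * 8) (5 + m * 8) ≡ following m
  fits₆ zero    = genFits-fitting 6 0 0 5 refl
  fits₆ (suc m) = genFits-periodic 14 5 (λ d → Gap′-≥9 d 6) 8 m

  -- In this table of recurrences the residues 1, 2 and 3 are represented by 9, 10 and 11, where the
  -- shape is the same for all `m` and the excluded part 2 does not arise. The parts 1 and 3 are
  -- left to `gen₁` and `gen₃`.
  largest₄ : ∀ m → genLargest (4 + m * 8) ≡ a * b * q ^′ 4 * q ^ (m * 8) * following m
  largest₄ m = genLargest-periodic 3 m refl refl (fits₄ m)

  largest₅ : ∀ m → genLargest (5 + m * 8) ≡ a * q ^′ 5 * q ^ (m * 8) * following m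
  largest₅ m = genLargest-periodic 4 m refl weight-a (fits₅ m)

  largest₆ : ∀ m → genLargest (6 + m * 8) ≡ a ^′ 2 * q ^′ 6 * q ^ (m * 8) * following m
  largest₆ m = genLargest-periodic 5 m refl (*-identityʳ (a ^′ 2)) (fits₆ m)

  largest₇ : ∀ m → genLargest (7 + m * 8) ≡ b * q ^′ 7 * q ^ (m * 8) * gen (1 + m * 8)
  largest₇ m = genLargest-periodic 6 m refl weight-b (genFits-periodic 7 1
    (Gap′-≥6 7 (gap′ 6 7) (gap′ 7 7) (gap′ 8 7)) 5 m)

  largest₈ : ∀ m → genLargest (8 + m * 8) ≡ a * b * q ^′ 8 * q ^ (m * 8) * gen (1 + m * 8)
  largest₈ m = genLargest-periodic 7 m refl refl (genFits-periodic 8 1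
    (Gap′-≥7 0 (gap′ 7 0) (gap′ 8 0)) 6 m)

  largest₉ : ∀ m → genLargest (9 + m * 8) ≡ a * q ^′ 9 * q ^ (m * 8) * gen (4 + m * 8)
  largest₉ m = genLargest-periodic 8 m refl weight-a (genFits-periodic 9 4
    (Gap′-≥5 1 (gap′ 5 1) (gap′ 6 1) (gap′ 7 1) (gap′ 8 1)) 4 m)

  largest₁₀ : ∀ m → genLargest (10 + m * 8) ≡ b ^′ 2 * q ^′ 10 * q ^ (m * 8) * gen (1 + m * 8)
  largest₁₀ m = genLargest-periodic 9 m refl (*-identityˡ (b ^′ 2)) (genFits-periodic 10 1 (λ d → Gap′-≥9 d 2) 8 m)

  largest₁₁ : ∀ m → genLargest (11 + m * 8) ≡ b * q ^′ 11 * q ^ (m * 8) * gen (5 + m * 8)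
  largest₁₁ m = genLargest-periodic 10 m refl weight-b (genFits-periodic 11 5
    (Gap′-≥6 3 (gap′ 6 3) (gap′ 7 3) (gap′ 8 3)) 5 m)

  largest₁₂ : ∀ m → genLargest (12 + m * 8) ≡ a * b * q ^′ 12 * q ^ (m * 8) * following (suc m)
  largest₁₂ m = genLargest-periodic 11 m refl refl (fits₄ (suc m))

  largest₁₃ : ∀ m → genLargest (13 + m * 8) ≡ a * q ^′ 13 * q ^ (m * 8) * following (suc m)
  largest₁₃ m = genLargest-periodic 12 m refl weight-a (fits₅ (suc m))

  largest₁₄ : ∀ m → genLargest (14 + m * 8) ≡ a ^′ 2 * q ^′ 14 * q ^ (m * 8) * following (suc m)
  largest₁₄ m = genLargest-periodic 13 m refl (*-identityʳ (a ^′ 2)) (fits₆ (suc m))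

  gen₁ : gen 1 ≡ 1 + a * q
  gen₁ = gen-step 0 refl (trans (genLargest-periodic 0 0 refl weight-a refl) (lemma a q))
    where
    lemma : ∀ a q → a * q ^′ 1 * 1 * 1 ≡ a * q
    lemma = solve-∀

  -- The summand 0 is the contribution of the excluded part 2.
  gen₃ : gen 3 ≡ 1 + a * q + 0 + b * q ^′ 3 * 1 * 1
  gen₃ = gen-step 2 (gen-step 1 gen₁ refl) (genLargest-periodic 2 0 refl weight-b (genFits-fitting 3 0 0 2 refl))

-- Induction over the period for the `D₄` polynomials

-- Here X = q^(8m), gᵢ = G_{8m+i}(a, b) and hᵢ = G_{8m+i}(b q², a q²); F and f are the
-- values of following m at (a, b) and at (b q², a q²).
module _ (a b q X : ℕ) where
  -- On the left `g₉` is expanded by the parts 7, 8 and 9; on the right stands `following (suc m)`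
  -- at (b q², a q²), expanded by the parts 4, 5 and 7.
  step₉ : ∀ {g₁ g₄ g₆ f h₁ h₃} → g₁ ≡ (1 + a * q) * f → g₄ ≡ (1 + a * q) * h₁ → g₆ ≡ (1 + a * q) * h₃ →
          g₆ + b * q ^′ 7 * X * g₁ + a * b * q ^′ 8 * X * g₁ + a * q ^′ 9 * X * g₄
          ≡ (1 + a * q) * (h₃ + (b * q ^′ 2) * (a * q ^′ 2) * q ^′ 4 * X * f + (b * q ^′ 2) * q ^′ 5 * X * f
                           + (a * q ^′ 2) * q ^′ 7 * X * h₁)
  step₉ {f = f} {h₁} {h₃} refl refl refl = identity a b q X f h₁ h₃
    where
    identity : ∀ a b q X f h₁ h₃ →
      (1 + a * q) * h₃ + b * q ^′ 7 * X * ((1 + a * q) * f) + a * b * q ^′ 8 * X * ((1 + a * q) * f)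
        + a * q ^′ 9 * X * ((1 + a * q) * h₁)
      ≡ (1 + a * q) * (h₃ + (b * q ^′ 2) * (a * q ^′ 2) * q ^′ 4 * X * f + (b * q ^′ 2) * q ^′ 5 * X * f
                           + (a * q ^′ 2) * q ^′ 7 * X * h₁)
    identity = solve-∀

  -- The contribution `e` of the part 7 at (b q², a q²) occurs in both equations and stays
  -- unexpanded; only the part 10 on the left has to match the part 6 on the right.
  step₁₀ : ∀ {g₁ g₉ f h₅ e} → g₁ ≡ (1 + a * q) * f → g₉ ≡ (1 + a * q) * (h₅ + e) →
           g₉ + b ^′ 2 * q ^′ 10 * X * g₁ ≡ (1 + a * q) * (h₅ + (b * q ^′ 2) ^′ 2 * q ^′ 6 * X * f + e)
  step₁₀ {f = f} {h₅} {e} refl refl = identity a b q X f h₅ e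
    where
    identity : ∀ a b q X f h₅ e →
      (1 + a * q) * (h₅ + e) + b ^′ 2 * q ^′ 10 * X * ((1 + a * q) * f)
      ≡ (1 + a * q) * (h₅ + (b * q ^′ 2) ^′ 2 * q ^′ 6 * X * f + e)
    identity = solve-∀

  -- (1 + a q) g₅ = g₆ + a q g₄ eliminates g₅, which has no counterpart on the right.
  step₁₂ : ∀ {g₁ g₄ g₅ g₆ g₁₀ F f h₁ h₃ h₇} →
           g₁ ≡ (1 + a * q) * f → g₄ ≡ (1 + a * q) * h₁ → g₆ ≡ (1 + a * q) * h₃ → g₁₀ ≡ (1 + a * q) * h₇ →
           g₅ ≡ g₄ + a * q ^′ 5 * X * F → g₆ ≡ g₅ + a ^′ 2 * q ^′ 6 * X * F →
           g₁₀ + b * q ^′ 11 * X * g₅ + a * b * q ^′ 12 * X * (g₅ + b * q ^′ 7 * X * g₁)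
           ≡ (1 + a * q) * (h₇ + (b * q ^′ 2) * (a * q ^′ 2) * q ^′ 8 * X * h₁
                            + (b * q ^′ 2) * q ^′ 9 * X * (h₃ + (b * q ^′ 2) * (a * q ^′ 2) * q ^′ 4 * X * f))
  step₁₂ {F = F} {f} {h₁} {h₃} {h₇} refl refl g₆≡ refl refl refl =
    -- `g₆` is known in two ways. `left` regroups until its expansion by `F` appears, which `g₆≡`
    -- replaces by its product form; this removes `F`.
    trans (left a b q X F f h₁ h₇)
      (trans (cong (λ g → (1 + a * q) * h₇
                      + b * q ^′ 11 * X * (g + a * q * ((1 + a * q) * h₁ + b * q ^′ 7 * X * ((1 + a * q) * f)))) g₆≡)
        (right a b q X f h₁ h₃ h₇))
    where
    left : ∀ a b q X F f h₁ h₇ →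
      (1 + a * q) * h₇ + b * q ^′ 11 * X * ((1 + a * q) * h₁ + a * q ^′ 5 * X * F)
        + a * b * q ^′ 12 * X * ((1 + a * q) * h₁ + a * q ^′ 5 * X * F + b * q ^′ 7 * X * ((1 + a * q) * f))
      ≡ (1 + a * q) * h₇ + b * q ^′ 11 * X * (((1 + a * q) * h₁ + a * q ^′ 5 * X * F + a ^′ 2 * q ^′ 6 * X * F)
                                             + a * q * ((1 + a * q) * h₁ + b * q ^′ 7 * X * ((1 + a * q) * f)))
    left = solve-∀
    right : ∀ a b q X f h₁ h₃ h₇ →
      (1 + a * q) * h₇ + b * q ^′ 11 * X * ((1 + a * q) * h₃
                                            + a * q * ((1 + a * q) * h₁ + b * q ^′ 7 * X * ((1 + a * q) * f)))
      ≡ (1 + a * q) * (h₇ + (b * q ^′ 2) * (a * q ^′ 2) * q ^′ 8 * X * h₁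
                            + (b * q ^′ 2) * q ^′ 9 * X * (h₃ + (b * q ^′ 2) * (a * q ^′ 2) * q ^′ 4 * X * f))
    right = solve-∀

  -- The coefficients of the parts 13 and 14 combine to `a * q ^′ 13 * X` times `1 + a * q`, so `g₅`
  -- again occurs only multiplied by `1 + a * q` and is eliminated as in `step₁₂`.
  step₁₄ : ∀ {g₁ g₄ g₅ g₆ g₁₂ F f h₁ h₃ h₉} →
           g₁ ≡ (1 + a * q) * f → g₄ ≡ (1 + a * q) * h₁ → g₆ ≡ (1 + a * q) * h₃ → g₁₂ ≡ (1 + a * q) * h₉ →
           g₅ ≡ g₄ + a * q ^′ 5 * X * F → g₆ ≡ g₅ + a ^′ 2 * q ^′ 6 * X * F →
           g₁₂ + a * q ^′ 13 * X * (g₅ + b * q ^′ 7 * X * g₁) + a ^′ 2 * q ^′ 14 * X * (g₅ + b * q ^′ 7 * X * g₁)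
           ≡ (1 + a * q) * (h₉ + (a * q ^′ 2) ^′ 2 * q ^′ 10 * X * h₁
                            + (a * q ^′ 2) * q ^′ 11 * X * (h₃ + (b * q ^′ 2) * (a * q ^′ 2) * q ^′ 4 * X * f
                                                          + (b * q ^′ 2) * q ^′ 5 * X * f))
  step₁₄ {F = F} {f} {h₁} {h₃} {h₉} refl refl g₆≡ refl refl refl =
    trans (left a b q X F f h₁ h₉)
      (trans (cong (λ g → (1 + a * q) * h₉
                      + a * q ^′ 13 * X * (g + a * q * ((1 + a * q) * h₁) + (1 + a * q) * (b * q ^′ 7 * X * ((1 + a * q) * f)))) g₆≡)
        (right a b q X f h₁ h₃ h₉))
    where
    left : ∀ a b q X F f h₁ h₉ →
      (1 + a * q) * h₉
        + a * q ^′ 13 * X * ((1 + a * q) * h₁ + a * q ^′ 5 * X * F + b * q ^′ 7 * X * ((1 + a * q) * f))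
        + a ^′ 2 * q ^′ 14 * X * ((1 + a * q) * h₁ + a * q ^′ 5 * X * F + b * q ^′ 7 * X * ((1 + a * q) * f))
      ≡ (1 + a * q) * h₉ + a * q ^′ 13 * X * (((1 + a * q) * h₁ + a * q ^′ 5 * X * F + a ^′ 2 * q ^′ 6 * X * F)
                          + a * q * ((1 + a * q) * h₁) + (1 + a * q) * (b * q ^′ 7 * X * ((1 + a * q) * f)))
    left = solve-∀
    right : ∀ a b q X f h₁ h₃ h₉ →
      (1 + a * q) * h₉ + a * q ^′ 13 * X * ((1 + a * q) * h₃ + a * q * ((1 + a * q) * h₁)
                                           + (1 + a * q) * (b * q ^′ 7 * X * ((1 + a * q) * f)))
      ≡ (1 + a * q) * (h₉ + (a * q ^′ 2) ^′ 2 * q ^′ 10 * X * h₁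
                            + (a * q ^′ 2) * q ^′ 11 * X * (h₃ + (b * q ^′ 2) * (a * q ^′ 2) * q ^′ 4 * X * f
                                                          + (b * q ^′ 2) * q ^′ 5 * X * f))
    right = solve-∀

module _ (a b q : ℕ) where
  private
    module G = D-generating a b q
    module H = D-generating (b * (q * q)) (a * (q * q)) q

  -- The last two equations are the pairing of 2N with 2N - 3 at 8m + 4 and 8m + 6. The first treats
  -- the odd index 8m + 1, since the parts 7, 8 and 10 are followed by `gen (1 + m * 8)`; its
  -- partner is `following m`.
  Invariant : ℕ → Set
  Invariant m = G.gen (1 + m * 8) ≡ (1 + a * q) * H.following m
              × G.gen (4 + m * 8) ≡ (1 + a * q) * H.gen (1 + m * 8)
              × G.gen (6 + m * 8) ≡ (1 + a * q) * H.gen (3 + m * 8)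

  -- Each of the equations for 9, 10, 12 and 14 uses the one before it. The one for 10 lies between
  -- components of the invariant and is what `D-functional` exports.
  module Step (m : ℕ) (inv : Invariant m) where
    private
      X   = q ^ (m * 8)
      I₁  = proj₁ inv
      I₄  = proj₁ (proj₂ inv)
      I₆  = proj₂ (proj₂ inv)

    h₄ : H.gen (4 + m * 8) ≡ H.gen (3 + m * 8) + (b * q ^′ 2) * (a * q ^′ 2) * q ^′ 4 * X * H.following m
    h₄ = H.gen-step (3 + m * 8) refl (H.largest₄ m)

    h₅ : H.gen (5 + m * 8) ≡ H.gen (3 + m * 8) + (b * q ^′ 2) * (a * q ^′ 2) * q ^′ 4 * X * H.following m
                             + (b * q ^′ 2) * q ^′ 5 * X * H.following m
    h₅ = H.gen-step (4 + m * 8) h₄ (H.largest₅ m)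

    I₉ : G.gen (9 + m * 8) ≡ (1 + a * q) * H.following (suc m)
    I₉ = trans
      (G.gen-step (8 + m * 8)
        (G.gen-step (7 + m * 8) (G.gen-step (6 + m * 8) refl (G.largest₇ m)) (G.largest₈ m)) (G.largest₉ m))
      (trans (step₉ a b q X I₁ I₄ I₆) (cong ((1 + a * q) *_) (sym (cong₂ _+_ h₅ (H.largest₇ m)))))

    I₁₀ : G.gen (10 + m * 8) ≡ (1 + a * q) * H.gen (7 + m * 8)
    I₁₀ = trans (G.gen-step (9 + m * 8) refl (G.largest₁₀ m))
      (trans (step₁₀ a b q X {h₅ = H.gen (5 + m * 8)} {H.genLargest (7 + m * 8)} I₁ I₉)
        (cong ((1 + a * q) *_) (sym (H.gen-step (6 + m * 8) (H.gen-step (5 + m * 8) refl (H.largest₆ m)) refl))))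

    following′ : G.following (suc m) ≡ G.gen (5 + m * 8) + b * q ^′ 7 * X * G.gen (1 + m * 8)
    following′ = cong (G.gen (5 + m * 8) +_) (G.largest₇ m)

    g₅ : G.gen (5 + m * 8) ≡ G.gen (4 + m * 8) + a * q ^′ 5 * X * G.following m
    g₅ = G.gen-step (4 + m * 8) refl (G.largest₅ m)

    g₆ : G.gen (6 + m * 8) ≡ G.gen (5 + m * 8) + a ^′ 2 * q ^′ 6 * X * G.following m
    g₆ = G.gen-step (5 + m * 8) refl (G.largest₆ m)

    I₁₂ : G.gen (12 + m * 8) ≡ (1 + a * q) * H.gen (9 + m * 8)
    I₁₂ = trans
      (G.gen-step (11 + m * 8) (G.gen-step (10 + m * 8) refl (G.largest₁₁ m))
        (trans (G.largest₁₂ m) (cong (a * b * q ^′ 12 * X *_) following′)))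
      (trans (step₁₂ a b q X I₁ I₄ I₆ I₁₀ g₅ g₆)
        (cong ((1 + a * q) *_) (sym (H.gen-step (8 + m * 8) (H.gen-step (7 + m * 8) refl (H.largest₈ m))
          (trans (H.largest₉ m) (cong ((b * q ^′ 2) * q ^′ 9 * X *_) h₄))))))

    I₁₄ : G.gen (14 + m * 8) ≡ (1 + a * q) * H.gen (11 + m * 8)
    I₁₄ = trans
      (G.gen-step (13 + m * 8)
        (G.gen-step (12 + m * 8) refl (trans (G.largest₁₃ m) (cong (a * q ^′ 13 * X *_) following′)))
        (trans (G.largest₁₄ m) (cong (a ^′ 2 * q ^′ 14 * X *_) following′)))
      (trans (step₁₄ a b q X I₁ I₄ I₆ I₁₂ g₅ g₆)
        (cong ((1 + a * q) *_) (sym (H.gen-step (10 + m * 8) (H.gen-step (9 + m * 8) refl (H.largest₁₀ m))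
          (trans (H.largest₁₁ m) (cong ((a * q ^′ 2) * q ^′ 11 * X *_) h₅))))))

  invariant : ∀ m → Invariant m
  invariant zero = trans G.gen₁ (sym (*-identityʳ _)) , base₄ , base₆
    where
    g₄ = G.gen-step 3 G.gen₃ (G.largest₄ 0)

    base₄ : G.gen 4 ≡ (1 + a * q) * H.gen 1
    base₄ = trans g₄ (trans (lemma a b q) (cong ((1 + a * q) *_) (sym H.gen₁)))
      where
      lemma : ∀ a b q →
        1 + a * q + 0 + b * q ^′ 3 * 1 * 1 + a * b * q ^′ 4 * 1 * 1 ≡ (1 + a * q) * (1 + b * (q * q) * q)
      lemma = solve-∀

    base₆ : G.gen 6 ≡ (1 + a * q) * H.gen 3
    base₆ = trans (G.gen-step 5 (G.gen-step 4 g₄ (G.largest₅ 0)) (G.largest₆ 0))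
                  (trans (lemma a b q) (cong ((1 + a * q) *_) (sym H.gen₃)))
      where
      lemma : ∀ a b q →
        1 + a * q + 0 + b * q ^′ 3 * 1 * 1 + a * b * q ^′ 4 * 1 * 1 + a * q ^′ 5 * 1 * 1 + a ^′ 2 * q ^′ 6 * 1 * 1
        ≡ (1 + a * q) * (1 + b * (q * q) * q + 0 + a * (q * q) * q ^′ 3 * 1 * 1)
      lemma = solve-∀
  invariant (suc m) = I₉ , I₁₂ , I₁₄
    where open Step m (invariant m)

  D-functional : ∀ m → G.gen (10 + m * 8) ≡ (1 + a * q) * H.gen (7 + m * 8)
  D-functional m = Step.I₁₀ m (invariant m)

D₄-exponents : ∀ {N} u v n → n ≤ N → multiplicity (u , v , n) (𝔻.exponents N) ≡ D₄ u v n
D₄-exponents u v n n≤N = 𝔻.#partitions-exponents (D₄-condition? u v) u v n n≤N (mk⇔ to from)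
  where
  to : ∀ {λs} → IsPartition n λs × D₄-Condition u v λs → 𝔻.Admissible λs × exponent λs ≡ (u , v , n)
  to ((_ , pos , sum≡) , ≢2 , gaps , u≡ , v≡) =
    (gaps , ≢2 , pos) , cong₂ _,_ (sym u≡) (cong₂ _,_ (sym v≡) sum≡)

  from : ∀ {λs} → 𝔻.Admissible λs × exponent λs ≡ (u , v , n) → IsPartition n λs × D₄-Condition u v λs
  from ((gaps , ≢2 , pos) , eq) =
    (Linked.map (λ {x} {y} → <⇒≤ ∘ Gap⇒> {x} {y}) gaps , pos , cong (proj₂ ∘ proj₂) eq) ,
    ≢2 , gaps , sym (cong proj₁ eq) , sym (cong (proj₁ ∘ proj₂) eq)

-- Partitions counted by C₄

module ℂ = Enumeration _>?_ id (≅? (1 ∷ 3 ∷ []) 4)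

module C-generating (a b q : ℕ) where
  open ℂ.Generating a b q public

  included : ∀ r m → does (≅? (1 ∷ 3 ∷ []) 4 (r + m * 8)) ≡ does (≅? (1 ∷ 3 ∷ []) 4 r)
  included r m = cong (λ s → does (_∈?_ _≟_ s (1 ∷ 3 ∷ []))) ([r+m*8]%4≡r%4 r m)

  even : ∀ k m {x} → does (≅? (1 ∷ 3 ∷ []) 4 (suc k)) ≡ false →
         gen (k + m * 8) ≡ x → gen (suc k + m * 8) ≡ x
  even k m excluded eq =
    trans (gen-step (k + m * 8) eq (genLargest-excluded (k + m * 8) (trans (included (suc k) m) excluded)))
          (+-identityʳ _)

  -- Any partition into smaller parts may follow, so an admissible part contributes a factor: these
  -- are the finite products.
  odd : ∀ k m {w x} → does (≅? (1 ∷ 3 ∷ []) 4 (suc k)) ≡ true →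
        a ^′ U (suc k ∷ []) * b ^′ V (suc k ∷ []) ≡ w →
        gen (k + m * 8) ≡ x → gen (suc k + m * 8) ≡ (1 + w * q ^′ suc k * q ^ (m * 8)) * x
  odd k m S w≡ eq = gen-step (k + m * 8) eq (genLargest-periodic k m (trans (included (suc k) m) S) w≡
    (trans (genFits-all (suc k + m * 8) (k + m * 8) s≤s) eq))

module _ (a b q : ℕ) where
  private
    module G = C-generating a b q
    module H = C-generating (b * (q * q)) (a * (q * q)) q

  -- The substitution turns the factor of each odd part k into that of k + 2, so the two products
  -- differ by the factor `1 + a * q` of the part 1.
  C-functional : ∀ m → G.gen (2 + m * 8) ≡ (1 + a * q) * H.gen (m * 8)
  C-functional zero = trans (G.even 1 0 refl (G.odd 0 0 refl (*-identityʳ a) refl)) (lemma a q)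
    where
    lemma : ∀ a q → (1 + a * q ^′ 1 * 1) * 1 ≡ (1 + a * q) * 1
    lemma = solve-∀
  C-functional (suc m) = trans g₁₀ (trans (lemma a b q (q ^ (m * 8)) (H.gen (m * 8))) (cong ((1 + a * q) *_) (sym h₈)))
    where
    g₁₀ = G.even 9 m refl (G.odd 8 m refl (*-identityʳ a)
            (G.even 7 m refl (G.odd 6 m refl (*-identityˡ b)
              (G.even 5 m refl (G.odd 4 m refl (*-identityʳ a)
                (G.even 3 m refl (G.odd 2 m refl (*-identityˡ b) (C-functional m))))))))
    h₈ = H.even 7 m refl (H.odd 6 m refl (*-identityˡ (a * (q * q)))
           (H.even 5 m refl (H.odd 4 m refl (*-identityʳ (b * (q * q)))
             (H.even 3 m refl (H.odd 2 m refl (*-identityˡ (a * (q * q)))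
               (H.even 1 m refl (H.odd 0 m refl (*-identityʳ (b * (q * q))) refl)))))))
    lemma : ∀ a b q X h →
      (1 + a * q ^′ 9 * X) * ((1 + b * q ^′ 7 * X) * ((1 + a * q ^′ 5 * X) * ((1 + b * q ^′ 3 * X) * ((1 + a * q) * h))))
      ≡ (1 + a * q) * ((1 + a * (q * q) * q ^′ 7 * X) * ((1 + b * (q * q) * q ^′ 5 * X) * ((1 + a * (q * q) * q ^′ 3 * X)
        * ((1 + b * (q * q) * q ^′ 1 * X) * h))))
    lemma = solve-∀

odd-part : ∀ x → x ≅ 1 ∷ 3 ∷ [] [mod 4 ] →
           U (x ∷ []) ≡ #parts (1 ∷ []) 4 (x ∷ []) × V (x ∷ []) ≡ #parts (3 ∷ []) 4 (x ∷ [])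
odd-part = mod-8-induction {λ x → x ≅ 1 ∷ 3 ∷ [] [mod 4 ] → Agree x} shift
  (λ r → ≅? (1 ∷ 3 ∷ []) 4 r →-dec (U (r ∷ []) ≟ _ ×-dec V (r ∷ []) ≟ _))
  where
  Agree : ℕ → Set
  Agree x = U (x ∷ []) ≡ #parts (1 ∷ []) 4 (x ∷ []) × V (x ∷ []) ≡ #parts (3 ∷ []) 4 (x ∷ [])

  shift : ∀ r m → (r ≅ 1 ∷ 3 ∷ [] [mod 4 ] → Agree r) → r + m * 8 ≅ 1 ∷ 3 ∷ [] [mod 4 ] → Agree (r + m * 8)
  shift r m p odd =
    let eq      = [r+m*8]%4≡r%4 r m
        U≡ , V≡ = p (subst (_∈ 1 ∷ 3 ∷ []) eq odd)
    in trans (U-periodic r m) (trans U≡ (sym (#parts-≡ (1 ∷ []) 4 (r + m * 8) r eq)))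
     , trans (V-periodic r m) (trans V≡ (sym (#parts-≡ (3 ∷ []) 4 (r + m * 8) r eq)))

odd-parts : ∀ {λs} → All (_≅ 1 ∷ 3 ∷ [] [mod 4 ]) λs →
            U λs ≡ #parts (1 ∷ []) 4 λs × V λs ≡ #parts (3 ∷ []) 4 λs
odd-parts [] = refl , refl
odd-parts {x ∷ λs} (p ∷ ps) =
  let U≡ , V≡ = odd-part x p ; Us≡ , Vs≡ = odd-parts ps in
    trans (U-∷ x λs) (trans (cong₂ _+_ U≡ Us≡) (sym (#parts-∷ (1 ∷ []) 4 x λs)))
  , trans (V-∷ x λs) (trans (cong₂ _+_ V≡ Vs≡) (sym (#parts-∷ (3 ∷ []) 4 x λs)))

Linked-> : ∀ {λs} → Linked _≥_ λs → Unique λs → Linked _>_ λs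
Linked-> []           _                     = []
Linked-> [-]          _                     = [-]
Linked-> (x≥y ∷ ps) ((x≢y ∷ _) ∷ λs!) = ≤∧≢⇒< x≥y (x≢y ∘ sym) ∷ Linked-> ps λs!

C₄-exponents : ∀ {N} u v n → n ≤ N → multiplicity (u , v , n) (ℂ.exponents N) ≡ C₄ u v n
C₄-exponents u v n n≤N = ℂ.#partitions-exponents (C₄-condition? u v) u v n n≤N (mk⇔ to from)
  where
  to : ∀ {λs} → IsPartition n λs × C₄-Condition u v λs → ℂ.Admissible λs × exponent λs ≡ (u , v , n)
  to ((dec , pos , sum≡) , λs! , odds , u≡ , v≡) =
    let U≡ , V≡ = odd-parts odds in
    (Linked-> dec λs! , odds , pos) , cong₂ _,_ (trans U≡ u≡) (cong₂ _,_ (trans V≡ v≡) sum≡)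

  from : ∀ {λs} → ℂ.Admissible λs × exponent λs ≡ (u , v , n) → IsPartition n λs × C₄-Condition u v λs
  from ((dec , odds , pos) , eq) =
    let U≡ , V≡ = odd-parts odds in
    (Linked.map <⇒≤ dec , pos , cong (proj₂ ∘ proj₂) eq) ,
    AllPairs.map >⇒≢ (Linked⇒AllPairs (λ x>y y>z → <-trans y>z x>y) dec) ,
    odds , trans (sym U≡) (cong proj₁ eq) , trans (sym V≡) (cong (proj₁ ∘ proj₂) eq)

-- Both counts satisfy the functional equation

n≤r+N*8 : ∀ {n N} r → n ≤ N → n ≤ r + N * 8
n≤r+N*8 {N = N} r n≤N = ≤-trans n≤N (≤-trans (m≤m*n N 8) (m≤n+m (N * 8) r))

C₄-Functional : Functional (λ (u , v , n) → C₄ u v n)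
C₄-Functional = record
  { initial    = λ n → trans (sym (C₄-exponents 0 0 n ≤-refl)) (ℂ.multiplicity-00 n n)
  ; lhs        = λ N → ℂ.exponents (10 + N * 8)
  ; rhs        = λ N → ℂ.exponents (8 + N * 8)
  ; lhs-f      = λ u v n n≤N → C₄-exponents u v n (n≤r+N*8 10 n≤N)
  ; rhs-f      = λ u v n n≤N → C₄-exponents u v n (n≤r+N*8 8 n≤N)
  ; functional = λ N a b q → trans (ℂ.Generating.∑-exponents a b q (10 + N * 8))
      (trans (C-functional a b q (suc N)) (cong ((1 + a * q) *_) (sym (ℂ.Generating.∑-exponents _ _ q (8 + N * 8)))))
  }

D₄-Functional : Functional (λ (u , v , n) → D₄ u v n)
D₄-Functional = record
  { initial    = λ n → trans (sym (D₄-exponents 0 0 n ≤-refl)) (𝔻.multiplicity-00 n n)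
  ; lhs        = λ N → 𝔻.exponents (10 + N * 8)
  ; rhs        = λ N → 𝔻.exponents (7 + N * 8)
  ; lhs-f      = λ u v n n≤N → D₄-exponents u v n (n≤r+N*8 10 n≤N)
  ; rhs-f      = λ u v n n≤N → D₄-exponents u v n (n≤r+N*8 7 n≤N)
  ; functional = λ N a b q → trans (𝔻.Generating.∑-exponents a b q (10 + N * 8))
      (trans (D-functional a b q N) (cong ((1 + a * q) *_) (sym (𝔻.Generating.∑-exponents _ _ q (7 + N * 8)))))
  }

theorem2p3 : (u v n : ℕ) → C₄ u v n ≡ D₄ u v n
theorem2p3 u v n = functional-unique C₄-Functional D₄-Functional n u v
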